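{- Let $R$ be a finite Frobenius ring, let $V=R^n$, and let $G$ be a finite permutation group on the coordinates of $V$. Let $H$ be a subgroup of $G$ such that $|H|$ has an inverse in $R$. If $C$ is a left $G$-code of length $n$ over $R$, then $$W^{H}_{(C^{\perp})\theta_H}(x,y) = \frac{1}{|C\theta_H|}\, W^{H}_{C\theta_H}\bigl(x+(|R|-1)y,\; x-y\bigr).$$
   Context: A finite (associative, unital) ring $R$ is Frobenius if $R/\mathrm{Rad}(R)\cong \mathrm{Soc}(R_R)$ as right $R$-modules and $R/\mathrm{Rad}(R)\cong\mathrm{Soc}({}_RR)$ as left $R$-modules. $R$ need not be commutative. On $V=R^n$ put $(u,v):=u_1v_1+\cdots+u_nv_n$. A permutation group $G$ on $\{1,\dots,n\}$ acts on $V$ on the right by $(vg)_i = v_{ig^{ -1}}$. A left $G$-code is a left $R$-submodule $C$ of $V$ with $Cg\subseteq C$ for all $g\in G$; its right dual is $C^{\perp}:=\{u\in V:(v,u)=0\text{ for all }v\in C\}$. "$|H|$ has an inverse in $R$" means $|H|\cdot 1_R$ is a unit. Define $v\theta_H:=\frac1{|H|}\sum_{h\in H}vh$ for $v\in V$ and $X\theta_H:=\{v\theta_H:v\in X\}$ for $X\subseteq V$. Let $H_V(\alpha_1),\dots,H_V(\alpha_t)$ be the orbits of $H$ on the coordinate set $\{1,\dots,n\}$, and let $\overline{H_V(\alpha_i)}\in V$ be the vector with entry $1$ at the positions in $H_V(\alpha_i)$ and $0$ elsewhere. Every $u\in V\theta_H$ is uniquely $u=\sum_{i=1}^t u_i\overline{H_V(\alpha_i)}$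 with $u_i\in R$; its $H$-weight is $\mathrm{wt}_H(u):=|\{i:u_i\ne0\}|$. For a left or right $R$-submodule $D\subseteq V\theta_H$, the $H$-weight enumerator is $W_D^H(x,y):=\sum_{u\in D}x^{t-\mathrm{wt}_H(u)}y^{\mathrm{wt}_H(u)}$. -}

module Defs where

open import Algebra.Bundles using (Ring)
open import Algebra.Bundles.Raw using (RawRing)
open import Algebra.Core using (Op₂)
import Algebra.Definitions as AlgebraDefinitions
import Algebra.Definitions.RawSemiring as RawSemiringDefinitions
open import Algebra.Module.Bundles.Raw using (RawLeftModule; RawRightModule)
open import Algebra.Module.Morphism.Structures
  using (module LeftModuleMorphisms; module RightModuleMorphisms)
import Algebra.Properties.CommutativeMonoid.Sum as CommutativeMonoidSum
import Algebra.Properties.Monoid.Mult as MonoidMult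
import Algebra.Properties.Ring as RingProperties
open import Data.Bool.Base using (if_then_else_)
open import Data.Fin.Base using (Fin; zero; suc; finToFun; funToFin)
open import Data.Fin.Permutation as Perm
  using (Permutation′; _⟨$⟩ʳ_; _⟨$⟩ˡ_; _∘ₚ_)
import Data.Fin.Properties as Fin
open import Data.List.Base as List using (List; []; _∷_)
open import Data.Nat.Base as ℕ using (ℕ; zero; suc; NonZero)
open import Data.Product.Base using (∃; _×_; _,_; proj₁; proj₂)
open import Data.Product using (∃!)
open import Data.Rational.Base as ℚ using (ℚ)
open import Data.Sum.Base using (_⊎_)
open import Data.Vec.Functional using (Vector)
import Data.Vec.Functional.Relation.Binary.Equality.Setoid as VectorEquality
open import Function.Base using (_∘_; flip)
open import Function.Bundles using (Inverse)
open import Level using (Level; 0ℓ; _⊔_) renaming (suc to lsuc)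
open import Relation.Binary.Bundles using (Setoid)
import Relation.Binary.Definitions as B
import Relation.Binary.PropositionalEquality as ≡
open import Relation.Binary.PropositionalEquality using (_≡_)
open import Relation.Nullary using (Dec; yes; no; does; ¬_; contradiction)
open import Relation.Nullary.Decidable
  using (map′; ¬?; _×-dec_; _→-dec_; dec-true; dec-false)
open import Relation.Unary using (Pred; Decidable; _⊆_; Universal)

-- Subsets of a finite set are taken decidable.  Classically this is no
-- restriction; constructively it is what lets maximality and minimality of
-- ideals, and cardinalities, have their usual meaning.
record Subset {a ℓ} (S : Setoid a ℓ) (p : Level) : Set (a ⊔ ℓ ⊔ lsuc p) where
  open Setoid S
  field
    Member   : Pred Carrier p
    respects : Member B.Respects _≈_
    member?  : Decidable Member

open Subset public

record FiniteRing c ℓ : Set (lsuc (c ⊔ ℓ)) where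
  field
    ring        : Ring c ℓ
    size        : ℕ
    enumeration : Inverse (Ring.setoid ring) (≡.setoid (Fin size))

  open Ring ring public hiding (zero)

  _≟_ : B.Decidable _≈_
  x ≟ y = map′ injective (Inverse.to-cong enumeration) (to x Fin.≟ to y)
    where
    open Inverse enumeration
    injective : ∀ {x y} → to x ≡ to y → x ≈ y
    injective {x} {y} eq =
      trans (sym (strictlyInverseʳ x)) (trans (from-cong eq) (strictlyInverseʳ y))

-- Ideals with respect to a scalar action _•_ of R on itself: r • x = r * x
-- gives left ideals, r • x = x * r gives right ideals.
module OneSided {c ℓ} (R : Ring c ℓ) (_•_ : Op₂ (Ring.Carrier R)) where
  open Ring R hiding (zero)

  record Ideal : Set (c ⊔ ℓ ⊔ lsuc 0ℓ) where
    field
      subset   : Subset setoid 0ℓ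
      0-closed : Member subset 0#
      +-closed : ∀ {x y} → Member subset x → Member subset y → Member subset (x + y)
      •-closed : ∀ r {x} → Member subset x → Member subset (r • x)

    Carrierᴵ : Pred Carrier 0ℓ
    Carrierᴵ = Member subset

  open Ideal using (Carrierᴵ)

  IsZero : Pred Ideal (c ⊔ ℓ)
  IsZero I = ∀ {x} → Carrierᴵ I x → x ≈ 0#

  Maximal : Pred Ideal (c ⊔ ℓ ⊔ lsuc 0ℓ)
  Maximal I = ¬ Universal (Carrierᴵ I) ×
    (∀ J → Carrierᴵ I ⊆ Carrierᴵ J → Carrierᴵ J ⊆ Carrierᴵ I ⊎ Universal (Carrierᴵ J))

  -- The minimal one-sided ideals are the simple submodules of the regular
  -- module.
  Minimal : Pred Ideal (c ⊔ ℓ ⊔ lsuc 0ℓ)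
  Minimal I = ¬ IsZero I ×
    (∀ J → Carrierᴵ J ⊆ Carrierᴵ I → Carrierᴵ I ⊆ Carrierᴵ J ⊎ IsZero J)

  -- The sum of all simple submodules: closed under _•_ because they are.
  data Soc : Pred Carrier (c ⊔ ℓ ⊔ lsuc 0ℓ) where
    simple   : ∀ {I x} → Minimal I → Carrierᴵ I x → Soc x
    0-closed : Soc 0#
    +-closed : ∀ {x y} → Soc x → Soc y → Soc (x + y)
    ≈-closed : ∀ {x y} → x ≈ y → Soc x → Soc y

module _ {c ℓ} (R : Ring c ℓ) where
  open Ring R hiding (zero)
  open RingProperties R using (-1*x≈-x; -‿distribʳ-*)

  module Left  = OneSided R _*_
  module Right = OneSided R (flip _*_)

  -- The Jacobson radical is left-right symmetric, so the intersection of the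
  -- maximal left ideals also serves for the right module R / Rad(R) below.
  Rad : Pred Carrier (c ⊔ ℓ ⊔ lsuc 0ℓ)
  Rad x = ∀ I → Left.Maximal I → Left.Ideal.Carrierᴵ I x

  *-closedˡ : ∀ r {x} → Left.Soc x → Left.Soc (r * x)
  *-closedˡ r (Left.simple {I} m x∈I) = Left.simple {I} m (Left.Ideal.•-closed I r x∈I)
  *-closedˡ r Left.0-closed = Left.≈-closed (sym (zeroʳ r)) Left.0-closed
  *-closedˡ r (Left.+-closed p q) =
    Left.≈-closed (sym (distribˡ r _ _)) (Left.+-closed (*-closedˡ r p) (*-closedˡ r q))
  *-closedˡ r (Left.≈-closed e p) = Left.≈-closed (*-congˡ e) (*-closedˡ r p)

  *-closedʳ : ∀ r {x} → Right.Soc x → Right.Soc (x * r)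
  *-closedʳ r (Right.simple {I} m x∈I) = Right.simple {I} m (Right.Ideal.•-closed I r x∈I)
  *-closedʳ r Right.0-closed = Right.≈-closed (sym (zeroˡ r)) Right.0-closed
  *-closedʳ r (Right.+-closed p q) =
    Right.≈-closed (sym (distribʳ r _ _)) (Right.+-closed (*-closedʳ r p) (*-closedʳ r q))
  *-closedʳ r (Right.≈-closed e p) = Right.≈-closed (*-congʳ e) (*-closedʳ r p)

  x*-1≈-x : ∀ x → x * - 1# ≈ - x
  x*-1≈-x x = trans (sym (-‿distribʳ-* x 1#)) (-‿cong (*-identityʳ x))

  -- R / Rad(R) is R itself with congruence modulo Rad(R) as its equality.
  leftModuloRad : RawLeftModule Carrier c (c ⊔ ℓ ⊔ lsuc 0ℓ)
  leftModuloRad = record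
    { Carrierᴹ = Carrier
    ; _≈ᴹ_     = λ x y → Rad (x - y)
    ; _+ᴹ_     = _+_
    ; _*ₗ_     = _*_
    ; 0ᴹ       = 0#
    ; -ᴹ_      = -_
    }

  rightModuloRad : RawRightModule Carrier c (c ⊔ ℓ ⊔ lsuc 0ℓ)
  rightModuloRad = record
    { Carrierᴹ = Carrier
    ; _≈ᴹ_     = λ x y → Rad (x - y)
    ; _+ᴹ_     = _+_
    ; _*ᵣ_     = _*_
    ; 0ᴹ       = 0#
    ; -ᴹ_      = -_
    }

  leftSocle : RawLeftModule Carrier (c ⊔ ℓ ⊔ lsuc 0ℓ) ℓ
  leftSocle = record
    { Carrierᴹ = ∃ Left.Soc
    ; _≈ᴹ_     = λ x y → proj₁ x ≈ proj₁ y
    ; _+ᴹ_     = λ { (x , p) (y , q) → x + y , Left.+-closed p q }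
    ; _*ₗ_     = λ { r (x , p) → r * x , *-closedˡ r p }
    ; 0ᴹ       = 0# , Left.0-closed
    ; -ᴹ_      = λ { (x , p) → - x , Left.≈-closed (-1*x≈-x x) (*-closedˡ (- 1#) p) }
    }

  rightSocle : RawRightModule Carrier (c ⊔ ℓ ⊔ lsuc 0ℓ) ℓ
  rightSocle = record
    { Carrierᴹ = ∃ Right.Soc
    ; _≈ᴹ_     = λ x y → proj₁ x ≈ proj₁ y
    ; _+ᴹ_     = λ { (x , p) (y , q) → x + y , Right.+-closed p q }
    ; _*ᵣ_     = λ { (x , p) r → x * r , *-closedʳ r p }
    ; 0ᴹ       = 0# , Right.0-closed
    ; -ᴹ_      = λ { (x , p) → - x , Right.≈-closed (x*-1≈-x x) (*-closedʳ (- 1#) p) }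
    }

  record IsFrobenius : Set (c ⊔ ℓ ⊔ lsuc 0ℓ) where
    open LeftModuleMorphisms leftModuloRad leftSocle
    open RightModuleMorphisms rightModuloRad rightSocle
    field
      right-iso : ∃ IsRightModuleIsomorphism
      left-iso  : ∃ IsLeftModuleIsomorphism

record PermutationGroup (n : ℕ) : Set where
  field
    order    : ℕ
    element  : Fin order → Permutation′ n
    distinct : ∀ {k l} → element k Perm.≈ element l → k ≡ l

  Elem : Pred (Permutation′ n) 0ℓ
  Elem g = ∃ λ k → g Perm.≈ element k

  -- g ∘ₚ h is "first g, then h", the product for permutations acting on the
  -- right.
  field
    id-closed   : Elem Perm.id
    ∘-closed    : ∀ g h → Elem g → Elem h → Elem (g ∘ₚ h)
    flip-closed : ∀ g → Elem g → Elem (Perm.flip g)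

open PermutationGroup using (order; element; Elem)

_≤ₚ_ : ∀ {n} → PermutationGroup n → PermutationGroup n → Set
H ≤ₚ G = Elem H ⊆ Elem G

module _ {n} (H : PermutationGroup n) where

  -- j ∈ H_V(i).
  InOrbit : Fin n → Fin n → Set
  InOrbit i j = ∃ λ k → element H k ⟨$⟩ʳ i ≡ j

  inOrbit? : B.Decidable InOrbit
  inOrbit? i j = Fin.any? (λ k → element H k ⟨$⟩ʳ i Fin.≟ j)

  -- α₁, …, αₜ with H_V(α₁), …, H_V(αₜ) the orbits of H, listed without
  -- repetition.
  record OrbitRepresentatives (t : ℕ) : Set where
    field
      α         : Fin t → Fin n
      partition : ∀ j → ∃! _≡_ (λ i → InOrbit (α i) j)

-- A[X]: lists of coefficients, constant term first, equal when they agree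
-- after padding with zeros.
module Univariate {a ℓ} (A : RawRing a ℓ) where
  open RawRing A

  coefficient : List Carrier → ℕ → Carrier
  coefficient []      _       = 0#
  coefficient (a ∷ p) zero    = a
  coefficient (a ∷ p) (suc k) = coefficient p k

  add : Op₂ (List Carrier)
  add []      q       = q
  add (a ∷ p) []      = a ∷ p
  add (a ∷ p) (b ∷ q) = a + b ∷ add p q

  mul : Op₂ (List Carrier)
  mul []      q = []
  mul (a ∷ p) q = add (List.map (a *_) q) (0# ∷ mul p q)

  rawRing : RawRing a ℓ
  rawRing = record
    { Carrier = List Carrier
    ; _≈_     = λ p q → ∀ k → coefficient p k ≈ coefficient q k
    ; _+_     = add
    ; _*_     = mul
    ; -_      = List.map -_
    ; 0#      = []
    ; 1#      = 1# ∷ []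
    }

  constant : Carrier → List Carrier
  constant a = a ∷ []

  X : List Carrier
  X = 0# ∷ 1# ∷ []

-- ℚ[x,y] = ℚ[x][y]
module ℚ[x] = Univariate ℚ.+-*-rawRing
module ℚ[x][y] = Univariate ℚ[x].rawRing

module ℚ[x,y] where
  open RawRing ℚ[x][y].rawRing public
  open RawSemiringDefinitions rawSemiring public using (sum; _^_)

  infixl 6 _-_

  _-_ : Op₂ Carrier
  p - q = p + (- q)

  x y : Carrier
  x = ℚ[x][y].constant ℚ[x].X
  y = ℚ[x][y].X

  scalar : ℚ → Carrier
  scalar q = ℚ[x][y].constant (ℚ[x].constant q)

module Codes {c ℓ} (R : FiniteRing c ℓ) where
  open FiniteRing R
  open Inverse enumeration using (to; from; strictlyInverseʳ; from-cong)
  open AlgebraDefinitions _≈_ using (Invertible)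
  open MonoidMult +-monoid using () renaming (_×_ to _×#_)
  open CommutativeMonoidSum +-commutativeMonoid
    using (sum; sum-cong-≋; sum-permute; sum-remove; sum-replicate-zero)
  open VectorEquality setoid using (_≋_; ≋-setoid)

  V : ℕ → Set c
  V n = Vector Carrier n

  VSubset : ℕ → (p : Level) → Set (c ⊔ ℓ ⊔ lsuc p)
  VSubset n = Subset (≋-setoid n)

  ⟨_,_⟩ : ∀ {n} → V n → V n → Carrier
  ⟨ u , v ⟩ = sum (λ i → u i * v i)

  -- (v g)ᵢ = v at i g⁻¹
  _·_ : ∀ {n} → V n → Permutation′ n → V n
  (v · g) i = v (g ⟨$⟩ˡ i)

  -- V n listed without repetition (up to _≋_).
  word : ∀ {n} → Fin (size ℕ.^ n) → V n
  word k i = from (finToFun k i)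

  index : ∀ {n} → V n → Fin (size ℕ.^ n)
  index v = funToFin (to ∘ v)

  word-index : ∀ {n} (v : V n) → word (index v) ≋ v
  word-index v i = trans (from-cong (Fin.finToFun-funToFin (to ∘ v) i)) (strictlyInverseʳ (v i))

  ∃? : ∀ {n p} {P : Pred (V n) p} → P B.Respects _≋_ → Decidable P → Dec (∃ P)
  ∃? resp P? = map′
    (λ (k , Pk) → word k , Pk)
    (λ (v , Pv) → index v , resp (λ i → sym (word-index v i)) Pv)
    (Fin.any? (P? ∘ word))

  ∀? : ∀ {n p} {P : Pred (V n) p} → P B.Respects _≋_ → Decidable P → Dec (∀ v → P v)
  ∀? resp P? = map′
    (λ Pw v → resp (word-index v) (Pw (index v)))
    (λ Pv k → Pv (word k))
    (Fin.all? (P? ∘ word))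

  ⟨⟩-congˡ : ∀ {n} {u v : V n} w → u ≋ v → ⟨ u , w ⟩ ≈ ⟨ v , w ⟩
  ⟨⟩-congˡ w u≋v = sum-cong-≋ (λ i → *-congʳ (u≋v i))

  ⟨⟩-congʳ : ∀ {n} w {u v : V n} → u ≋ v → ⟨ w , u ⟩ ≈ ⟨ w , v ⟩
  ⟨⟩-congʳ w u≋v = sum-cong-≋ (λ i → *-congˡ (u≋v i))

  ∣_∣ : ∀ {n p} → VSubset n p → ℕ
  ∣_∣ {n} D = ℕsum (λ k → if does (member? D (word k)) then 1 else 0)
    where open RawSemiringDefinitions ℕ.+-*-rawSemiring using () renaming (sum to ℕsum)

  record LeftGCode {n} (G : PermutationGroup n) (p : Level) : Set (c ⊔ ℓ ⊔ lsuc p) where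
    field
      codewords : VSubset n p
      0-closed  : Member codewords (λ _ → 0#)
      +-closed  : ∀ {u v} → Member codewords u → Member codewords v →
                  Member codewords (λ i → u i + v i)
      *-closed  : ∀ r {v} → Member codewords v → Member codewords (λ i → r * v i)
      ·-closed  : ∀ g {v} → Elem G g → Member codewords v → Member codewords (v · g)

  open LeftGCode public using (codewords)

  _⊥ : ∀ {n p} → VSubset n p → VSubset n (c ⊔ ℓ ⊔ p)
  C ⊥ = record
    { Member   = λ u → ∀ v → Member C v → ⟨ v , u ⟩ ≈ 0#
    ; respects = λ e u⊥ v v∈C → trans (sym (⟨⟩-congʳ v e)) (u⊥ v v∈C)
    ; member?  = λ u → ∀?
        (λ e u⊥ v∈C → trans (sym (⟨⟩-congˡ u e)) (u⊥ (respects C (λ i → sym (e i)) v∈C)))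
        (λ v → member? C v →-dec (⟨ v , u ⟩ ≟ 0#))
    }

  InvertibleOrder : ∀ {n} → PermutationGroup n → Set (c ⊔ ℓ)
  InvertibleOrder H = Invertible 1# _*_ (order H ×# 1#)

  module Averaging {n} (H : PermutationGroup n) (1/∣H∣ : InvertibleOrder H) where

    _θ : V n → V n
    (v θ) i = proj₁ 1/∣H∣ * sum (λ k → (v · element H k) i)

    θ-cong : ∀ {u v} → u ≋ v → (u θ) ≋ (v θ)
    θ-cong u≋v i = *-congˡ (sum-cong-≋ (λ k → u≋v (element H k ⟨$⟩ˡ i)))

    0θ≋0 : ((λ _ → 0#) θ) ≋ (λ _ → 0#)
    0θ≋0 i = trans (*-congˡ (sum-replicate-zero (order H))) (zeroʳ _)

    _[θ] : ∀ {p} → VSubset n p → VSubset n (c ⊔ ℓ ⊔ p)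
    X [θ] = record
      { Member   = λ u → ∃ λ v → Member X v × u ≋ (v θ)
      ; respects = λ e (v , v∈X , eq) → v , v∈X , (λ i → trans (sym (e i)) (eq i))
      ; member?  = λ u → ∃?
          (λ e (v∈X , eq) → respects X e v∈X , (λ i → trans (eq i) (θ-cong e i)))
          (λ v → member? X v ×-dec Fin.all? (λ i → u i ≟ (v θ) i))
      }

    -- With ∣_∣-nonZero, this is what makes 1 / ∣ C [θ] ∣ meaningful.
    0∈[θ] : ∀ {p} (X : VSubset n p) → Member X (λ _ → 0#) → Member (X [θ]) (λ _ → 0#)
    0∈[θ] X 0∈X = (λ _ → 0#) , 0∈X , (λ i → sym (0θ≋0 i))

    θ-invariant : ∀ v k i → (v θ) (element H k ⟨$⟩ʳ i) ≈ (v θ) i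
    θ-invariant v k i = *-congˡ (sym (trans
      (sum-permute (λ m → v (element H m ⟨$⟩ˡ i)) σ)
      (sum-cong-≋ (λ m → reflexive (≡.cong v (shift m))))))
      where
      open PermutationGroup H using (distinct; ∘-closed; flip-closed)
      g = element H k
      g∈H : Elem H g
      g∈H = k , λ _ → ≡.refl
      fwd bwd : ∀ m → ∃ λ l → _
      fwd m = ∘-closed (element H m) (Perm.flip g) (m , λ _ → ≡.refl) (flip-closed g g∈H)
      bwd m = ∘-closed (element H m) g (m , λ _ → ≡.refl) g∈H
      σ : Permutation′ (order H)
      σ = Perm.permutation (proj₁ ∘ fwd) (proj₁ ∘ bwd)
        (λ m → distinct (λ j → ≡.trans (≡.sym (proj₂ (fwd (proj₁ (bwd m))) j))
          (≡.trans (≡.cong (g ⟨$⟩ˡ_) (≡.sym (proj₂ (bwd m) j))) (Perm.inverseˡ g))))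
        (λ m → distinct (λ j → ≡.trans (≡.sym (proj₂ (bwd (proj₁ (fwd m))) j))
          (≡.trans (≡.cong (g ⟨$⟩ʳ_) (≡.sym (proj₂ (fwd m) j))) (Perm.inverseʳ g))))
      shift : ∀ m → element H (σ ⟨$⟩ʳ m) ⟨$⟩ˡ i ≡ element H m ⟨$⟩ˡ (g ⟨$⟩ʳ i)
      shift m = ≡.trans (≡.cong (h′ ⟨$⟩ˡ_) i≡) (Perm.inverseˡ h′)
        where
        h′ = element H (σ ⟨$⟩ʳ m)
        h = element H m
        i≡ : i ≡ h′ ⟨$⟩ʳ (h ⟨$⟩ˡ (g ⟨$⟩ʳ i))
        i≡ = ≡.sym (≡.trans (≡.sym (proj₂ (fwd m) _))
          (≡.trans (≡.cong (g ⟨$⟩ˡ_) (Perm.inverseʳ h)) (Perm.inverseˡ g)))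

  ∣_∣-nonZero : ∀ {n p} (D : VSubset n p) {v} → Member D v → NonZero ∣ D ∣
  ∣ D ∣-nonZero {v} v∈D = positive _ (index v)
    (≡.cong (λ b → if b then 1 else 0)
      (dec-true (member? D _) (respects D (λ i → sym (word-index v i)) v∈D)))
    where
    open RawSemiringDefinitions ℕ.+-*-rawSemiring using () renaming (sum to ℕsum)
    positive : ∀ {m} (f : Fin m → ℕ) k → f k ≡ 1 → NonZero (ℕsum f)
    positive f zero    eq rewrite eq = _
    positive f (suc k) eq with f zero
    ... | zero  = positive (f ∘ suc) k eq
    ... | suc _ = _

  module _ {n t} {H : PermutationGroup n} (orbits : OrbitRepresentatives H t) where
    open OrbitRepresentatives orbits

    orbitVector : Fin t → V n
    orbitVector i j = if does (inOrbit? H (α i) j) then 1# else 0#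

    combination : V t → V n
    combination a j = sum (λ i → a i * orbitVector i j)

    -- For u ∈ Vθ these are the coefficients of u in terms of the orbit
    -- vectors: see coordinates-expand and coordinates-unique below.
    coordinates : V n → V t
    coordinates u i = u (α i)

    H-weight : V n → ℕ
    H-weight u = List.length (List.filter (λ i → ¬? (coordinates u i ≟ 0#)) (List.allFin t))

    -- Takes the two variables as arguments, so that substituting
    -- polynomials for them is application.
    weightEnumerator : ∀ {p} → VSubset n p → ℚ[x,y].Carrier → ℚ[x,y].Carrier → ℚ[x,y].Carrier
    weightEnumerator D X Y = P.sum λ k →
      let u = word k in
      if does (member? D u)
      then X P.^ (t ℕ.∸ H-weight u) P.* Y P.^ H-weight u
      else P.0#
      where module P = ℚ[x,y]

    single : ∀ {m} (f : Fin m → Carrier) i → (∀ j → ¬ i ≡ j → f j ≈ 0#) → sum f ≈ f i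
    single {suc m} f i f≈0 = trans (sum-remove {i = i} f)
      (trans (+-congˡ (trans (sum-cong-≋ (λ j → f≈0 _ (λ eq → Fin.punchInᵢ≢i i j (≡.sym eq))))
                             (sum-replicate-zero m)))
             (+-identityʳ _))

    combination-at : ∀ a i j → InOrbit H (α i) j → combination a j ≈ a i
    combination-at a i j i∼j = trans (single _ i off) on
      where
      i≡ : ∀ {i′} → InOrbit H (α i′) j → i ≡ i′
      i≡ i′∼j = ≡.trans (≡.sym (proj₂ (proj₂ (partition j)) i∼j))
                        (proj₂ (proj₂ (partition j)) i′∼j)
      off : ∀ i′ → ¬ i ≡ i′ → a i′ * orbitVector i′ j ≈ 0#
      off i′ i≢i′ with inOrbit? H (α i′) j
      ... | yes i′∼j = contradiction (i≡ i′∼j) i≢i′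
      ... | no  _    = zeroʳ _
      on : a i * orbitVector i j ≈ a i
      on with inOrbit? H (α i) j
      ... | yes _   = *-identityʳ _
      ... | no ¬i∼j = contradiction i∼j ¬i∼j

    coordinates-unique : ∀ {u a} → u ≋ combination a → coordinates u ≋ a
    coordinates-unique {u} {a} eq i =
      trans (eq (α i)) (combination-at a i (α i) (proj₁ id∈H , ≡.sym (proj₂ id∈H (α i))))
      where id∈H = PermutationGroup.id-closed H

    module _ (1/∣H∣ : InvertibleOrder H) where
      open Averaging H 1/∣H∣

      coordinates-expand : ∀ v → (v θ) ≋ combination (coordinates (v θ))
      coordinates-expand v j with partition j
      ... | i , (k , αi·k≡j) , _ = trans
        (trans (reflexive (≡.cong (v θ) (≡.sym αi·k≡j))) (θ-invariant v k (α i)))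
        (sym (combination-at _ i j (k , αi·k≡j)))

{-# OPTIONS --safe #-}

-- Let M = R/Rad(R).  For a maximal left ideal I, the right annihilator r(I) lies in the left socle,
-- which is isomorphic to M, so r(I) embeds into Hom(R/I, M); since M is semisimple and
-- ∣Hom(S, T)∣ = ∣Hom(T, S)∣ for simple S and T, this has at most ∣Hom(M, R/I)∣ ≤ ∣R/I∣ elements.
-- Hence ∣D⊥∣ ∣D∣ ≤ ∣E⊥∣ ∣E∣ whenever D ⊆ E ⊆ Rᵗ are left submodules with E/D simple, and so for
-- all D ⊆ E.  Both 0 and Rᵗ give ∣R∣ᵗ, so ∣D⊥∣ ∣D∣ = ∣R∣ᵗ for every D.  Applied to
-- D + {v : v vanishes on S} for all S ⊆ [t], this is the MacWilliams identity for Rᵗ after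
-- expanding the products of the weight enumerator over S.  In orbit coordinates the form of Rⁿ
-- restricted to Vθ becomes Σ mᵢ uᵢ vᵢ, where the orbit sizes mᵢ are units of R, and (C⊥)θ is the
-- orthogonal of Cθ for this form.

module Submission where

open import Algebra.Bundles using (CommutativeMonoid; CommutativeRing; RawRing; Ring; Semiring)
import Algebra.Definitions.RawSemiring as RawSemiringDefinitions
open import Algebra.Module.Morphism.Structures using (module LeftModuleMorphisms)
import Algebra.Properties.CommutativeMonoid.Sum as CommutativeMonoidSum
import Algebra.Properties.CommutativeSemigroup as CommutativeSemigroupProperties
import Algebra.Properties.Ring as RingProperties
import Algebra.Properties.Semiring.Mult as SemiringMult
import Algebra.Properties.Semiring.Sum as SemiringSum
open import Data.Bool.Base as Bool using (Bool; true; false; not; _∧_; if_then_else_)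
import Data.Bool.Properties as Bool
open import Data.Fin.Base using (Fin; zero; suc; combine; remQuot; finToFun; funToFin)
open import Data.Fin.Permutation as Perm using (_⟨$⟩ʳ_; _⟨$⟩ˡ_)
import Data.Fin.Properties as Fin
open import Data.Integer.Base as ℤ using (+_)
import Data.Integer.Properties as ℤ
open import Data.List.Base as List using (List; []; _∷_)
import Data.List.Properties as List
open import Data.Nat.Base as ℕ using (ℕ; zero; suc; _≤_; _<_; NonZero)
import Data.Nat.Properties as ℕ
open import Data.Nat.Tactic.RingSolver using (solve-∀)
open import Data.Product.Base using (∃; _×_; _,_; proj₁; proj₂; map; uncurry)
open import Data.Product.Relation.Binary.Pointwise.NonDependent using (×-setoid)
open import Data.Rational.Base as ℚ using (_/_; 1ℚ) renaming (_-_ to _-ℚ_)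
import Data.Rational.Properties as ℚ
open import Data.Rational.Unnormalised.Base as ℚᵘ using (mkℚᵘ; *≡*)
import Data.Rational.Unnormalised.Properties as ℚᵘ
open import Data.Sum.Base using (inj₁; inj₂)
open import Data.Unit.Base using (⊤; tt)
open import Data.Vec.Base using (Vec; []; _∷_; lookup)
open import Data.Vec.Functional using () renaming (_∷_ to _∷ᶠ_)
import Data.Vec.Functional.Relation.Binary.Equality.Setoid as VectorEquality
open import Function.Base using (_∘_; id)
open import Function.Bundles using (Inverse; mk⇔)
import Function.Construct.Composition as Composition
open import Function.Construct.Identity using () renaming (inverse to identity)
import Function.Construct.Symmetry as Symmetry
open import Level using (Level; 0ℓ; _⊔_)
open import Relation.Binary.Bundles using (Setoid)
import Relation.Binary.Definitions as Rel
import Relation.Binary.PropositionalEquality as ≡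
open import Relation.Binary.PropositionalEquality using (_≡_)
import Relation.Binary.Reasoning.Setoid as SetoidReasoning
open import Relation.Nullary using (yes; no; does; contradiction; Dec; ¬_)
open import Relation.Nullary.Decidable
  using (T?; True; toWitness; fromWitness; map′; does-⇔; dec-true; decidable-stable; ¬?; _×-dec_; _→-dec_)
open import Relation.Unary using (Pred; Decidable)
open import Defs

-- Counting in finite setoids

-- Characters are avoided altogether: every estimate is an injection between finite setoids.
-- Quotient modules are avoided as well. A homomorphism from R/I to R/K is right multiplication by
-- some x with I x ⊆ K, determined up to K, so `I ⇒ K` has `♯ K` elements for each homomorphism.
-- With hom(I, K) = `♯ (I ⇒ K)` / `♯ K`, all inequalities between numbers of homomorphisms appear
-- below with denominators cleared. Nor is M decomposed into simple modules. The inequality hom(I,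
-- K) ≤ hom(K, I) is carried along a descending sequence of left ideals K, from K = R down to K =
-- Rad(R), each obtained from the previous one by intersecting with a maximal ideal. The obstacle is
-- that `Rad` quantifies over all maximal ideals and carries no decision procedure, so it cannot be
-- reached by a search. It is met only inside an argument by contradiction, which is legitimate
-- because the bound sought compares two natural numbers.

private variable
  a ℓ a′ ℓ′ a″ ℓ″ p q : Level
  A : Setoid a ℓ
  B : Setoid a′ ℓ′
  K : Setoid a″ ℓ″
  k m n : ℕ

-- Written exactly like `∣_∣`, so that `cardinality (V-finite n) D` and `∣ D ∣` agree by definition.
count : {P : Pred (Fin n) p} → Decidable P → ℕ
count P? = ℕsum (λ i → if does (P? i) then 1 else 0)
  where open RawSemiringDefinitions ℕ.+-*-rawSemiring using () renaming (sum to ℕsum)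

module _ {P : Pred (Fin (suc n)) p} where

  -- The decision at `zero` is a separate argument of this and the following lemmas, so that
  -- matching on it reduces the first summand of `count`.
  nth-step : (d : Dec (P zero)) → (Fin k → ∃ (P ∘ suc)) →
             Fin ((if does d then 1 else 0) ℕ.+ k) → ∃ P
  nth-step (yes p) f zero    = zero , p
  nth-step (yes _) f (suc j) = map suc id (f j)
  nth-step (no _)  f j       = map suc id (f j)

  rank-step : (d : Dec (P zero)) → (∀ i → P (suc i) → Fin k) →
              ∀ i → P i → Fin ((if does d then 1 else 0) ℕ.+ k)
  rank-step (yes _) g zero    p = zero
  rank-step (no ¬p) g zero    p = contradiction p ¬p
  rank-step (yes _) g (suc i) p = suc (g i p)
  rank-step (no _)  g (suc i) p = g i p

  rank-step-irrelevant : (d : Dec (P zero)) {g : ∀ i → P (suc i) → Fin k} →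
    (∀ i p q → g i p ≡ g i q) → ∀ i p q → rank-step d g i p ≡ rank-step d g i q
  rank-step-irrelevant (yes _) eq zero    p q = ≡.refl
  rank-step-irrelevant (no ¬p) eq zero    p q = contradiction p ¬p
  rank-step-irrelevant (yes _) eq (suc i) p q = ≡.cong suc (eq i p q)
  rank-step-irrelevant (no _)  eq (suc i) p q = eq i p q

  nth-rank-step : (d : Dec (P zero)) {f : Fin k → ∃ (P ∘ suc)} {g : ∀ i → P (suc i) → Fin k} →
    (∀ i p → proj₁ (f (g i p)) ≡ i) → ∀ i p → proj₁ (nth-step d f (rank-step d g i p)) ≡ i
  nth-rank-step (yes _) eq zero    p = ≡.refl
  nth-rank-step (no ¬p) eq zero    p = contradiction p ¬p
  nth-rank-step (yes _) eq (suc i) p = ≡.cong suc (eq i p)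
  nth-rank-step (no _)  eq (suc i) p = ≡.cong suc (eq i p)

  rank-nth-step : (d : Dec (P zero)) {f : Fin k → ∃ (P ∘ suc)} {g : ∀ i → P (suc i) → Fin k} →
    (∀ j p → g (proj₁ (f j)) p ≡ j) → ∀ j p → rank-step d g (proj₁ (nth-step d f j)) p ≡ j
  rank-nth-step (yes _) eq zero    p = ≡.refl
  rank-nth-step (yes _) eq (suc j) p = ≡.cong suc (eq j p)
  rank-nth-step (no _)  eq j       p = eq j p

nth : {P : Pred (Fin n) p} (P? : Decidable P) → Fin (count P?) → ∃ P
nth {n = suc n} P? = nth-step (P? zero) (nth (P? ∘ suc))

rank : {P : Pred (Fin n) p} (P? : Decidable P) → ∀ i → P i → Fin (count P?)
rank {n = suc n} P? = rank-step (P? zero) (rank (P? ∘ suc))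

rank-irrelevant : {P : Pred (Fin n) p} (P? : Decidable P) → ∀ i p q → rank P? i p ≡ rank P? i q
rank-irrelevant {n = suc n} P? = rank-step-irrelevant (P? zero) (rank-irrelevant (P? ∘ suc))

nth-rank : {P : Pred (Fin n) p} (P? : Decidable P) → ∀ i p → proj₁ (nth P? (rank P? i p)) ≡ i
nth-rank {n = suc n} P? = nth-rank-step (P? zero) (nth-rank (P? ∘ suc))

rank-nth : {P : Pred (Fin n) p} (P? : Decidable P) → ∀ j p → rank P? (proj₁ (nth P? j)) p ≡ j
rank-nth {n = suc n} P? = rank-nth-step (P? zero) (rank-nth (P? ∘ suc))

module _ {a ℓ} (M : CommutativeMonoid a ℓ) where
  open CommutativeMonoid M
  open CommutativeMonoidSum M using (sum)

  -- Replaces an indicator inside a sum by an enumeration of the members, which can then be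
  -- reindexed along a bijection.
  sum-filter : {P : Pred (Fin n) p} (P? : Decidable P) (f : Fin n → Carrier) →
               sum (λ i → if does (P? i) then f i else ε) ≈ sum (f ∘ proj₁ ∘ nth P?)
  sum-filter {n = zero}  P? f = refl
  sum-filter {n = suc n} P? f with P? zero
  ... | yes _ = ∙-congˡ (sum-filter (P? ∘ suc) (f ∘ suc))
  ... | no _  = trans (identityˡ _) (sum-filter (P? ∘ suc) (f ∘ suc))

Finite : Setoid a ℓ → ℕ → Set _
Finite S n = Inverse S (≡.setoid (Fin n))

module Enumeration {A : Setoid a ℓ} (e : Finite A n) where
  open Setoid A
  open Inverse e public

  to-injective : ∀ {x y} → to x ≡ to y → x ≈ y
  to-injective {x} {y} eq =
    trans (sym (strictlyInverseʳ x)) (trans (from-cong eq) (strictlyInverseʳ y))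

  from-injective : ∀ {i j} → from i ≈ from j → i ≡ j
  from-injective {i} {j} eq =
    ≡.trans (≡.sym (strictlyInverseˡ i)) (≡.trans (to-cong eq) (strictlyInverseˡ j))

  search : {P : Pred Carrier p} → P Rel.Respects _≈_ → Decidable P → Dec (∃ P)
  search resp P? = map′
    (λ (i , Pi) → from i , Pi)
    (λ (x , Px) → to x , resp (sym (strictlyInverseʳ x)) Px)
    (Fin.any? (P? ∘ from))

  check : {P : Pred Carrier p} → P Rel.Respects _≈_ → Decidable P → Dec (∀ x → P x)
  check resp P? = map′
    (λ Pf x → resp (strictlyInverseʳ x) (Pf (to x)))
    (λ Px i → Px (from i))
    (Fin.all? (P? ∘ from))

injection⇒≤ : Finite A m → Finite B n →
              (f : Setoid.Carrier A → Setoid.Carrier B) →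
              (∀ {x y} → Setoid._≈_ B (f x) (f y) → Setoid._≈_ A x y) → m ≤ n
injection⇒≤ eA eB f f-injective = Fin.injective⇒≤ {f = B.to ∘ f ∘ A.from}
  (A.from-injective ∘ f-injective ∘ B.to-injective)
  where
  module A = Enumeration eA
  module B = Enumeration eB

infixr 2 _×ᶠ_

_×ᶠ_ : Finite A m → Finite B n → Finite (×-setoid A B) (m ℕ.* n)
_×ᶠ_ {m = m} {n = n} eA eB = record
  { to        = λ (x , y) → combine (A.to x) (B.to y)
  ; from      = λ k → A.from (proj₁ (remQuot n k)) , B.from (proj₂ (remQuot {m} n k))
  ; to-cong   = λ (x≈ , y≈) → ≡.cong₂ combine (A.to-cong x≈) (B.to-cong y≈)
  ; from-cong = λ eq → A.from-cong (≡.cong (proj₁ ∘ remQuot n) eq)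
                     , B.from-cong (≡.cong (proj₂ ∘ remQuot {m} n) eq)
  ; inverse   =
      (λ {k} {_} (x≈ , y≈) → ≡.trans
        (≡.cong₂ combine (A.inverseˡ x≈) (B.inverseˡ y≈))
        (Fin.combine-remQuot {m} n k))
    , (λ {xy} eq → A.inverseʳ (≡.trans (≡.cong (proj₁ ∘ remQuot n) eq)
                                     (≡.cong proj₁ (Fin.remQuot-combine (A.to (proj₁ xy)) (B.to (proj₂ xy)))))
          , B.inverseʳ (≡.trans (≡.cong (proj₂ ∘ remQuot {m} n) eq)
                                     (≡.cong proj₂ (Fin.remQuot-combine (A.to (proj₁ xy)) (B.to (proj₂ xy))))))
  }
  where
  module A = Enumeration eA
  module B = Enumeration eB

-- A canonical representative in each fibre of `f`. It depends on the value `f i` alone because it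
-- is the witness returned by the search over that fibre, whatever witness showed the fibre to be
-- inhabited.
section : (f : Fin m → Fin n) → ∃ λ (r : Fin m → Fin m) →
          (∀ i → f (r i) ≡ f i) × (∀ {i j} → f i ≡ f j → r i ≡ r j)
section f = (λ i → proj₁ (rep i)) , (λ i → proj₂ (rep i)) , (λ {i} {j} → rep-cong i j)
  where
  preimage? : ∀ b → Dec (∃ λ i → f i ≡ b)
  preimage? b = Fin.any? (λ i → f i Fin.≟ b)
  choose : ∀ {b} → Dec (∃ λ i → f i ≡ b) → (∃ λ i → f i ≡ b) → ∃ λ i → f i ≡ b
  choose (yes w) _ = w
  choose (no ¬w) w = contradiction w ¬w
  rep : ∀ i → ∃ λ j → f j ≡ f i
  rep i = choose (preimage? (f i)) (i , ≡.refl)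
  choose-const : ∀ {b} (d : Dec (∃ λ i → f i ≡ b)) v w → choose d v ≡ choose d w
  choose-const (yes _) v w = ≡.refl
  choose-const (no ¬w) v w = contradiction w ¬w
  lemma : ∀ i {b} (eq : f i ≡ b) → proj₁ (rep i) ≡ proj₁ (choose (preimage? b) (i , eq))
  lemma i ≡.refl = ≡.refl
  rep-cong : ∀ i j → f i ≡ f j → proj₁ (rep i) ≡ proj₁ (rep j)
  rep-cong i j eq = ≡.trans (lemma i eq)
    (≡.cong proj₁ (choose-const (preimage? (f j)) (i , eq) (j , ≡.refl)))

-- ∣A∣ ≤ ∣ker φ∣ ∣B∣, with δ x y in the role of x - y.
fibre-bound : Finite A m → Finite B n → Finite K k →
  (φ : Setoid.Carrier A → Setoid.Carrier B) →
  (δ : ∀ x y → Setoid._≈_ B (φ x) (φ y) → Setoid.Carrier K) →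
  (∀ {x y z} s t → Setoid._≈_ B (φ x) (φ y) → Setoid._≈_ K (δ x z s) (δ y z t) →
   Setoid._≈_ A x y) →
  m ≤ k ℕ.* n
fibre-bound {A = A} {K = K} eA eB eK φ δ δ-injective = Fin.injective⇒≤ {f = f} f-injective
  where
  module A = Enumeration eA
  module B = Enumeration eB
  module K = Enumeration eK
  g = B.to ∘ φ ∘ A.from
  r = proj₁ (section g)
  gr≡g = proj₁ (proj₂ (section g))
  r-cong = proj₂ (proj₂ (section g))
  d : ∀ i j → g j ≡ g i → Setoid.Carrier K
  d i j eq = δ (A.from i) (A.from j) (B.to-injective (≡.sym eq))
  -- Each point is recorded by its image and its difference from the representative of its fibre.
  -- Equal images have the same representative, so equal differences then force equal points.
  f : Fin _ → Fin _
  f i = combine (K.to (d i (r i) (gr≡g i))) (g i)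
  cancel : ∀ i j {i′ j′} s t → i′ ≡ j′ → g i ≡ g j → K.to (d i i′ s) ≡ K.to (d j j′ t) → i ≡ j
  cancel i j s t ≡.refl gi≡gj eq = A.from-injective
    (δ-injective _ _ (B.to-injective gi≡gj) (K.to-injective eq))
  f-injective : ∀ {i j} → f i ≡ f j → i ≡ j
  f-injective {i} {j} eq with Fin.combine-injective (K.to (d i (r i) (gr≡g i))) (g i) _ _ eq
  ... | d≡ , g≡ = cancel i j _ _ (r-cong g≡) g≡ d≡

-- ∣ker φ∣ ∣B∣ ≤ ∣A∣ for surjective φ, with τ the translation action of the kernel.
fibre-bound-surjective : Finite A m → Finite B n → Finite K k →
  (φ : Setoid.Carrier A → Setoid.Carrier B) →
  (∀ {x y} → Setoid._≈_ A x y → Setoid._≈_ B (φ x) (φ y)) →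
  (∀ y → ∃ λ x → Setoid._≈_ B (φ x) y) →
  (τ : Setoid.Carrier K → Setoid.Carrier A → Setoid.Carrier A) →
  (∀ s x → Setoid._≈_ B (φ (τ s x)) (φ x)) →
  (∀ {s t x} → Setoid._≈_ A (τ s x) (τ t x) → Setoid._≈_ K s t) →
  k ℕ.* n ≤ m
fibre-bound-surjective {A = A} {m = m} {B = B} {n = n} {k = k} eA eB eK φ φ-cong onto τ φτ τ-injective =
  Fin.injective⇒≤ {f = f} f-injective
  where
  module A = Enumeration eA
  module B = Enumeration eB
  module K = Enumeration eK
  open Setoid B
  h : Fin k × Fin n → Setoid.Carrier A
  h (s , j) = τ (K.from s) (proj₁ (onto (B.from j)))
  φh : ∀ sj → φ (h sj) ≈ B.from (proj₂ sj)
  φh (s , j) = trans (φτ _ _) (proj₂ (onto (B.from j)))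
  h-injective : ∀ {x y} → Setoid._≈_ A (h x) (h y) → x ≡ y
  h-injective {s , j} {t , j′} eq
    with ≡.refl ← B.from-injective (trans (sym (φh (s , j))) (trans (φ-cong eq) (φh (t , j′))))
    = ≡.cong (_, j) (K.from-injective (τ-injective eq))
  f : Fin (k ℕ.* n) → Fin m
  f i = A.to (h (remQuot {k} n i))
  f-injective : ∀ {i j} → f i ≡ f j → i ≡ j
  f-injective {i} {j} eq = ≡.trans (≡.sym (Fin.combine-remQuot {k} n i))
    (≡.trans (≡.cong (uncurry combine) (h-injective (A.to-injective eq)))
             (Fin.combine-remQuot {k} n j))

members : {S : Setoid a ℓ} → Subset S p → Setoid _ _
members {S = S} D = record
  { Carrier = ∃ (Member D)
  ; _≈_ = λ x y → proj₁ x ≈ proj₁ y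
  ; isEquivalence = record { refl = refl ; sym = sym ; trans = trans }
  }
  where open Setoid S

module _ {S : Setoid a ℓ} (e : Finite S n) where
  open Enumeration e
  open Setoid S using (sym; trans)

  cardinality : Subset S p → ℕ
  cardinality D = count (member? D ∘ from)

  finite-members : (D : Subset S p) → Finite (members D) (cardinality D)
  finite-members D = record
    { to        = λ (x , x∈D) → rank? (to x) (respects D (sym (strictlyInverseʳ x)) x∈D)
    ; from      = λ j → from (proj₁ (nth? j)) , proj₂ (nth? j)
    ; to-cong   = λ {(x , s)} {(y , t)} x≈y → rank-cong (to-cong x≈y)
    ; from-cong = λ eq → from-cong (≡.cong (proj₁ ∘ nth?) eq)
    ; inverse   =
        (λ {j} x≈ → ≡.trans
          (rank-cong (≡.trans (to-cong x≈) (strictlyInverseˡ _)))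
          (rank-nth (member? D ∘ from) j (proj₂ (nth? j))))
      , (λ {(x , s)} eq → trans
          (from-cong (≡.trans (≡.cong (proj₁ ∘ nth?) eq) (nth-rank (member? D ∘ from) _ _)))
          (strictlyInverseʳ x))
    }
    where
    nth? = nth (member? D ∘ from)
    rank? = rank (member? D ∘ from)
    rank-cong : ∀ {i j s t} → i ≡ j → rank? i s ≡ rank? j t
    rank-cong ≡.refl = rank-irrelevant (member? D ∘ from) _ _ _

  cardinality-nonZero : (D : Subset S p) → ∀ {x} → Member D x → NonZero (cardinality D)
  cardinality-nonZero D {x} x∈D = Fin.nonZeroIndex (Inverse.to (finite-members D) (x , x∈D))

finite-unique : Finite A m → Finite A n → m ≡ n
finite-unique eA eA′ = ℕ.≤-antisym
  (injection⇒≤ eA eA′ id id) (injection⇒≤ eA′ eA id id)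

module _ {S : Setoid a ℓ} (e : Finite S n) (D : Subset S p) (E : Subset S q) where
  open Setoid S
  open Enumeration

  cardinality-mono : (∀ {x} → Member D x → Member E x) → cardinality e D ≤ cardinality e E
  cardinality-mono D⊆E = injection⇒≤ (finite-members e D) (finite-members e E)
    (λ (x , x∈D) → x , D⊆E x∈D) id

  cardinality-strict : (∀ {x} → Member D x → Member E x) →
    ∀ {x} → Member E x → ¬ Member D x → cardinality e D < cardinality e E
  cardinality-strict D⊆E {x} x∈E x∉D = Fin.injective⇒≤ {f = f} f-injective
    where
    module D = Enumeration (finite-members e D)
    module E = Enumeration (finite-members e E)
    f : Fin (suc (cardinality e D)) → Fin (cardinality e E)
    f zero    = E.to (x , x∈E)
    f (suc i) = E.to (proj₁ (D.from i) , D⊆E (proj₂ (D.from i)))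
    f-injective : ∀ {i j} → f i ≡ f j → i ≡ j
    f-injective {zero}  {zero}  eq = ≡.refl
    f-injective {zero}  {suc j} eq =
      contradiction (respects D (sym (E.to-injective eq)) (proj₂ (D.from j))) x∉D
    f-injective {suc i} {zero}  eq =
      contradiction (respects D (E.to-injective eq) (proj₂ (D.from i))) x∉D
    f-injective {suc i} {suc j} eq = ≡.cong suc (D.from-injective (E.to-injective eq))

-- `Ideal` and `Submodule` ask for membership at level `0ℓ`, whereas membership in a generated ideal
-- or a sum quantifies over ring elements or vectors. Passing to `True` of the decision lowers the
-- level.
compress : ∀ {a ℓ p} {S : Setoid a ℓ} → Subset S p → Subset S 0ℓ
compress D = record
  { Member   = λ x → True (member? D x)
  ; respects = λ {x} {y} x≈y → fromWitness ∘ respects D x≈y ∘ toWitness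
  ; member?  = λ x → T? _
  }

-- Arithmetic of the counting estimates

module Inequalities where
  open import Data.Nat.Base using (_*_; _+_)
  open ℕ.≤-Reasoning

  -- In fractions: x′/k′ ≤ (x/k)(xl/l) ≤ (y/i)(yl/i) ≤ y′/i. Here x′/k′, x/k and xl/l count
  -- homomorphisms from R/I to the quotients by K ∩ L, K and L, while y′/i, y/i and yl/i count those
  -- in the opposite direction.
  balance : ∀ {x′ k l k′ x xl y yl i y′} {{_ : NonZero k}} {{_ : NonZero l}} {{_ : NonZero i}} →
    x′ * (k * l) ≤ k′ * (x * xl) → y * yl ≤ i * y′ →
    xl * i ≤ l * yl → x * i ≤ y * k → x′ * i ≤ y′ * k′
  balance {x′} {k} {l} {k′} {x} {xl} {y} {yl} {i} {y′} h₁ h₂ h₃ h₄ =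
    ℕ.*-cancelʳ-≤ _ _ (k * l * i) {{ℕ.m*n≢0 _ _ {{ℕ.m*n≢0 k l}}}} (begin
    x′ * i * (k * l * i)            ≡⟨ eq₁ x′ i k l ⟩
    x′ * (k * l) * (i * i)          ≤⟨ ℕ.*-monoˡ-≤ (i * i) h₁ ⟩
    k′ * (x * xl) * (i * i)         ≡⟨ eq₂ k′ x xl i ⟩
    k′ * ((x * i) * (xl * i))       ≤⟨ ℕ.*-monoʳ-≤ k′ (ℕ.*-mono-≤ h₄ h₃) ⟩
    k′ * ((y * k) * (l * yl))       ≡⟨ eq₃ k′ y k l yl ⟩
    (k′ * k * l) * (y * yl)         ≤⟨ ℕ.*-monoʳ-≤ (k′ * k * l) h₂ ⟩
    (k′ * k * l) * (i * y′)         ≡⟨ eq₄ k′ k l i y′ ⟩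
    y′ * k′ * (k * l * i)           ∎)
    where
    eq₁ : ∀ x′ i k l → x′ * i * (k * l * i) ≡ x′ * (k * l) * (i * i)
    eq₁ = solve-∀
    eq₂ : ∀ k′ x xl i → k′ * (x * xl) * (i * i) ≡ k′ * ((x * i) * (xl * i))
    eq₂ = solve-∀
    eq₃ : ∀ k′ y k l yl → k′ * ((y * k) * (l * yl)) ≡ (k′ * k * l) * (y * yl)
    eq₃ = solve-∀
    eq₄ : ∀ k′ k l i y′ → (k′ * k * l) * (i * y′) ≡ y′ * k′ * (k * l * i)
    eq₄ = solve-∀

  -- In fractions: a ≤ x/k ≤ y/i ≤ q/i, for a the size of the annihilator of I, and x/k and y/i the
  -- numbers of homomorphisms R/I → M and M → R/I.
  cancel-balanced : ∀ {a k i x y q} {{_ : NonZero k}} →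
    a * k ≤ x → x * i ≤ y * k → y ≤ q → a * i ≤ q
  cancel-balanced {a} {k} {i} {x} {y} {q} h₁ h₂ h₃ = ℕ.*-cancelʳ-≤ _ _ k (begin
    a * i * k   ≡⟨ eq a i k ⟩
    a * k * i   ≤⟨ ℕ.*-monoˡ-≤ i h₁ ⟩
    x * i       ≤⟨ h₂ ⟩
    y * k       ≤⟨ ℕ.*-monoˡ-≤ k h₃ ⟩
    q * k       ∎)
    where
    eq : ∀ a i k → a * i * k ≡ a * k * i
    eq = solve-∀

  -- When D grows to D + Rd, its orthogonal shrinks by a factor of at most a, D itself grows by a
  -- factor of at least q/i, and a ≤ q/i.
  cyclic-bound : ∀ {o o′ d d′ i a} q {{_ : NonZero q}} →
    o ≤ o′ * a → d * q ≤ i * d′ → a * i ≤ q → o * d ≤ o′ * d′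
  cyclic-bound {o} {o′} {d} {d′} {i} {a} q h₁ h₂ h₃ = ℕ.*-cancelʳ-≤ _ _ q (begin
    o * d * q             ≡⟨ ℕ.*-assoc o d q ⟩
    o * (d * q)           ≤⟨ ℕ.*-mono-≤ h₁ h₂ ⟩
    (o′ * a) * (i * d′)   ≡⟨ eq o′ a i d′ ⟩
    (o′ * d′) * (a * i)   ≤⟨ ℕ.*-monoʳ-≤ (o′ * d′) h₃ ⟩
    (o′ * d′) * q         ∎)
    where
    eq : ∀ o′ a i d′ → (o′ * a) * (i * d′) ≡ (o′ * d′) * (a * i)
    eq = solve-∀

  -- The recursion of `chain` runs on a bound for e - d, written without subtraction. An f strictly
  -- below e lowers the bound for the part from d to f, and an f strictly above d lowers it for the
  -- part from f to e.
  fuelˡ : ∀ {d f e n} → f < e → e ≤ suc n + d → f ≤ n + d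
  fuelˡ f<e e≤ = ℕ.s≤s⁻¹ (ℕ.<-≤-trans f<e e≤)

  fuelʳ : ∀ {d f e n} → d < f → e ≤ suc n + d → e ≤ n + f
  fuelʳ {d} {f} {e} {n} d<f e≤ = begin
    e            ≤⟨ e≤ ⟩
    suc n + d    ≡⟨ ℕ.+-suc n d ⟨
    n + suc d    ≤⟨ ℕ.+-monoʳ-≤ n d<f ⟩
    n + f        ∎

  transfer-count : ∀ {o p w q d z k} → o ≡ p → o * w ≡ q → d * z ≡ k * w → p * d * z ≡ k * q
  transfer-count {o} {_} {w} {q} {d} {z} {k} ≡.refl ow≡q dz≡kw = begin-equality
    o * d * z       ≡⟨ ℕ.*-assoc o d z ⟩
    o * (d * z)     ≡⟨ ≡.cong (o *_) dz≡kw ⟩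
    o * (k * w)     ≡⟨ eq o k w ⟩
    k * (o * w)     ≡⟨ ≡.cong (k *_) ow≡q ⟩
    k * q           ∎
    where
    eq : ∀ o k w → o * (k * w) ≡ k * (o * w)
    eq = solve-∀

open Inequalities

-- Identities for differences in a ring

module _ {c ℓ} (R : Ring c ℓ) where
  open Ring R hiding (zero)
  open RingProperties R
  open SetoidReasoning setoid

  x-y+y≈x : ∀ x y → (x - y) + y ≈ x
  x-y+y≈x x y = trans (+-assoc x (- y) y) (trans (+-congˡ (-‿inverseˡ y)) (+-identityʳ x))

  x+y-y≈x : ∀ x y → (x + y) - y ≈ x
  x+y-y≈x x y = trans (+-assoc x y (- y)) (trans (+-congˡ (-‿inverseʳ y)) (+-identityʳ x))

  x-z≈y-z⇒x≈y : ∀ {x y z} → x - z ≈ y - z → x ≈ y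
  x-z≈y-z⇒x≈y {x} {y} {z} eq = +-cancelʳ (- z) x y eq

  x+y≈z+w⇒x-z≈w-y : ∀ {x y z w} → x + y ≈ z + w → x - z ≈ w - y
  x+y≈z+w⇒x-z≈w-y {x} {y} {z} {w} eq = begin
    x - z               ≈⟨ +-congʳ (sym (x+y-y≈x x y)) ⟩
    (x + y - y) - z     ≈⟨ +-congʳ (+-congʳ eq) ⟩
    (z + w - y) - z     ≈⟨ +-congʳ (+-assoc z w (- y)) ⟩
    (z + (w - y)) - z   ≈⟨ xyx⁻¹≈y z (w - y) ⟩
    w - y               ∎

  1-y*z : ∀ y z → (1# - y) * z ≈ z - y * z
  1-y*z y z = trans ([y-z]x≈yx-zx z 1# y) (+-congʳ (*-identityˡ z))

  x-y+z-w≈x+z-[y+w] : ∀ x y z w → (x - y) + (z - w) ≈ (x + z) - (y + w)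
  x-y+z-w≈x+z-[y+w] x y z w = begin
    (x - y) + (z - w)       ≈⟨ +-assoc _ _ _ ⟩
    x + (- y + (z - w))     ≈⟨ +-congˡ (+-assoc _ _ _) ⟨
    x + ((- y + z) - w)     ≈⟨ +-congˡ (+-congʳ (+-comm _ _)) ⟩
    x + ((z - y) - w)       ≈⟨ +-congˡ (+-assoc _ _ _) ⟩
    x + (z + (- y - w))     ≈⟨ +-assoc _ _ _ ⟨
    (x + z) + (- y - w)     ≈⟨ +-congˡ (-‿+-comm _ _) ⟩
    (x + z) - (y + w)       ∎

  sub-interchange : ∀ x r y s b → (x - r * b) + (y - s * b) ≈ (x + y) - (r + s) * b
  sub-interchange x r y s b = trans (x-y+z-w≈x+z-[y+w] x (r * b) y (s * b))
    (+-congˡ (-‿cong (sym (distribʳ b r s))))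

-- Annihilators of maximal left ideals

module LeftIdeals {c ℓ} (R : FiniteRing c ℓ) where
  open FiniteRing R
  open Enumeration enumeration using (search; check)
  open RingProperties ring
  open SetoidReasoning setoid
  open Left ring using (Ideal; Maximal; Minimal)
  open Ideal

  infix 4 _∈_ _∉_
  infix 5 _⇒_

  _∈_ _∉_ : Carrier → Ideal → Set
  x ∈ I = Member (subset I) x
  x ∉ I = ¬ x ∈ I

  _∈?_ : ∀ x I → Dec (x ∈ I)
  x ∈? I = member? (subset I) x

  ∈-resp : ∀ I {x y} → x ≈ y → x ∈ I → y ∈ I
  ∈-resp I = respects (subset I)

  neg-closed : ∀ I {x} → x ∈ I → - x ∈ I
  neg-closed I {x} x∈I = ∈-resp I (-1*x≈-x x) (•-closed I (- 1#) x∈I)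

  sub-closed : ∀ I {x y} → x ∈ I → y ∈ I → x - y ∈ I
  sub-closed I x∈I y∈I = +-closed I x∈I (neg-closed I y∈I)

  ♯ : ∀ {p} → Subset setoid p → ℕ
  ♯ = cardinality enumeration

  ♯-finite : ∀ {p} (D : Subset setoid p) → Finite (members D) (♯ D)
  ♯-finite = finite-members enumeration

  ♯-nonZero : ∀ I → NonZero (♯ (subset I))
  ♯-nonZero I = cardinality-nonZero enumeration (subset I) (0-closed I)

  -- Simplicity of R/I in terms of elements: every nonzero class generates the class of 1. Unlike
  -- `Maximal`, this does not quantify over ideals, and it is the form in which `chain` obtains
  -- maximality of `colon`.
  IsMaximal : Pred Ideal _
  IsMaximal I = 1# ∉ I × (∀ r → r ∉ I → ∃ λ s → 1# - s * r ∈ I)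

  principal : Carrier → Ideal
  principal b = record
    { subset   = compress S
    ; 0-closed = fromWitness (0# , sym (zeroˡ b))
    ; +-closed = λ x∈ y∈ → let r , x≈ = toWitness x∈ ; s , y≈ = toWitness y∈ in
        fromWitness (r + s , trans (+-cong x≈ y≈) (sym (distribʳ b r s)))
    ; •-closed = λ r x∈ → let s , x≈ = toWitness x∈ in
        fromWitness (r * s , trans (*-congˡ x≈) (sym (*-assoc r s b)))
    }
    where
    S : Subset setoid _
    S = record
      { Member   = λ x → ∃ λ r → x ≈ r * b
      ; respects = λ x≈y (r , x≈rb) → r , trans (sym x≈y) x≈rb
      ; member?  = λ x → search (λ r≈s → λ x≈rb → trans x≈rb (*-congʳ r≈s)) (λ r → x ≟ (r * b))
      }

  adjoin : Ideal → Carrier → Ideal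
  adjoin I b = record
    { subset   = compress S
    ; 0-closed = fromWitness (0# , ∈-resp I (sym (trans (+-congˡ (-‿cong (zeroˡ b))) (-‿inverseʳ 0#))) (0-closed I))
    ; +-closed = λ {x} {y} x∈ y∈ → let r , p = toWitness x∈ ; s , q = toWitness y∈ in
        fromWitness (r + s , ∈-resp I (sub-interchange ring x r y s b) (+-closed I p q))
    ; •-closed = λ r {x} x∈ → let s , p = toWitness x∈ in
        fromWitness (r * s , ∈-resp I
          (trans (x[y-z]≈xy-xz r x (s * b)) (+-congˡ (-‿cong (sym (*-assoc r s b)))))
          (•-closed I r p))
    }
    where
    S : Subset setoid _
    S = record
      { Member   = λ x → ∃ λ r → x - r * b ∈ I
      ; respects = λ x≈y (r , p) → r , ∈-resp I (+-congʳ x≈y) p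
      ; member?  = λ x → search (λ r≈s → ∈-resp I (+-congˡ (-‿cong (*-congʳ r≈s)))) (λ r → (x - r * b) ∈? I)
      }

  maximal⇒isMaximal : ∀ {I} → Maximal I → IsMaximal I
  maximal⇒isMaximal {I} (proper , max) = 1∉I , generates
    where
    1∉I : 1# ∉ I
    1∉I 1∈I = proper (λ x → ∈-resp I (*-identityʳ x) (•-closed I x 1∈I))
    generates : ∀ r → r ∉ I → ∃ λ s → 1# - s * r ∈ I
    generates r r∉I with max (adjoin I r) (λ {x} x∈I → fromWitness (0# , ∈-resp I
      (sym (trans (+-congˡ (trans (-‿cong (zeroˡ r)) -0#≈0#)) (+-identityʳ x))) x∈I))
    ... | inj₁ J⊆I = contradiction (J⊆I (fromWitness (1# , ∈-resp I
      (sym (trans (+-congˡ (-‿cong (*-identityˡ r))) (-‿inverseʳ r))) (0-closed I)))) r∉I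
    ... | inj₂ J=R = toWitness (J=R 1#)

  _∩_ : Ideal → Ideal → Ideal
  K ∩ L = record
    { subset   = record
      { Member   = λ x → x ∈ K × x ∈ L
      ; respects = λ x≈y (x∈K , x∈L) → ∈-resp K x≈y x∈K , ∈-resp L x≈y x∈L
      ; member?  = λ x → (x ∈? K) ×-dec (x ∈? L)
      }
    ; 0-closed = 0-closed K , 0-closed L
    ; +-closed = λ (a , b) (c , d) → +-closed K a c , +-closed L b d
    ; •-closed = λ r (a , b) → •-closed K r a , •-closed L r b
    }

  -- {x : I x ⊆ K}, which modulo K is Hom(R / I, R / K).
  _⇒_ : Ideal → Ideal → Subset setoid c
  I ⇒ K = record
    { Member   = λ x → ∀ r → r ∈ I → r * x ∈ K
    ; respects = λ x≈y f r r∈I → ∈-resp K (*-congˡ x≈y) (f r r∈I)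
    ; member?  = λ x → check
        (λ r≈s f s∈I → ∈-resp K (*-congʳ r≈s) (f (∈-resp I (sym r≈s) s∈I)))
        (λ r → (r ∈? I) →-dec ((r * x) ∈? K))
    }

  -- The right annihilator of `I`, that is Hom(R/I, R) with x as the image of 1. It is a right
  -- ideal, hence recorded as a subset only.
  annihilator : Ideal → Subset setoid (c ⊔ ℓ)
  annihilator I = record
    { Member   = λ x → ∀ r → r ∈ I → r * x ≈ 0#
    ; respects = λ x≈y f r r∈I → trans (*-congˡ (sym x≈y)) (f r r∈I)
    ; member?  = λ x → check
        (λ r≈s f s∈I → trans (*-congʳ (sym r≈s)) (f (∈-resp I (sym r≈s) s∈I)))
        (λ r → (r ∈? I) →-dec ((r * x) ≟ 0#))
    }

  module _ (I K : Ideal) where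

    ⊆⇒ : ∀ {x} → x ∈ K → Member (I ⇒ K) x
    ⊆⇒ x∈K r _ = •-closed K r x∈K

    ⇒-+ : ∀ {x y} → Member (I ⇒ K) x → Member (I ⇒ K) y → Member (I ⇒ K) (x + y)
    ⇒-+ f g r r∈I = ∈-resp K (sym (distribˡ r _ _)) (+-closed K (f r r∈I) (g r r∈I))

    ⇒-sub : ∀ {x y} → Member (I ⇒ K) x → Member (I ⇒ K) y → Member (I ⇒ K) (x - y)
    ⇒-sub f g r r∈I = ∈-resp K (sym (x[y-z]≈xy-xz r _ _)) (sub-closed K (f r r∈I) (g r r∈I))

    -- A nonzero homomorphism out of the simple module R / I is injective.
    ⇒-faithful : IsMaximal I → ∀ {x r} → Member (I ⇒ K) x → x ∉ K → r * x ∈ K → r ∈ I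
    ⇒-faithful (_ , max) {x} {r} f x∉K rx∈K with r ∈? I
    ... | yes r∈I = r∈I
    ... | no  r∉I = let s , p = max r r∉I in contradiction
      (∈-resp K (x-y+y≈x ring x (s * (r * x)))
        (+-closed K
          (∈-resp K (trans (1-y*z ring (s * r) x) (+-congˡ (-‿cong (*-assoc s r x)))) (f _ p))
          (•-closed K s rx∈K)))
      x∉K

  -- This is hom(I, L) ≤ hom(L, I). A nonzero homomorphism x : R/I → R/L between simple modules has
  -- an inverse y, and composing on both sides, x′ ↦ y x′ y, is an injection of Hom(R/I, R/L) into
  -- Hom(R/L, R/I).
  ⇒-symmetric : ∀ I L → IsMaximal I → IsMaximal L →
                ♯ (I ⇒ L) ℕ.* ♯ (subset I) ≤ ♯ (subset L) ℕ.* ♯ (L ⇒ I)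
  ⇒-symmetric I L maxI maxL
    with search resp (λ x → member? (I ⇒ L) x ×-dec ¬? (x ∈? L))
    where
    resp : (λ x → Member (I ⇒ L) x × x ∉ L) Rel.Respects _≈_
    resp x≈y (f , x∉L) = respects (I ⇒ L) x≈y f , x∉L ∘ ∈-resp L (sym x≈y)
  -- Without a nonzero homomorphism `I ⇒ L` lies in `L`, while `I` always lies in `L ⇒ I`.
  ... | no ¬∃ = ℕ.*-mono-≤
    (cardinality-mono enumeration (I ⇒ L) (subset L)
      (λ {x} f → decidable-stable (x ∈? L) (λ x∉L → ¬∃ (x , f , x∉L))))
    (cardinality-mono enumeration (subset I) (L ⇒ I) (⊆⇒ L I))
  ... | yes (x , f , x∉L) = fibre-bound (♯-finite (I ⇒ L) ×ᶠ ♯-finite (subset I))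
      (♯-finite (L ⇒ I)) (♯-finite (subset L)) φ δ
      (λ _ _ φ≈ δ≈ → let x≈ = x-z≈y-z⇒x≈y ring δ≈ in
        x≈ , +-cancelˡ _ _ _ (trans φ≈ (+-congʳ (*-congʳ (*-congˡ (sym x≈))))))
    where
    y = proj₁ (proj₂ maxL x x∉L)
    1-yx∈L : 1# - y * x ∈ L
    1-yx∈L = proj₂ (proj₂ maxL x x∉L)
    -- Since y x ≡ 1 modulo L, l y x is in L for every l in L, and faithfulness of x puts l y in I.
    y∈L⇒I : Member (L ⇒ I) y
    y∈L⇒I l l∈L = ⇒-faithful I L maxI f x∉L (∈-resp L eq
      (sub-closed L l∈L (•-closed L l 1-yx∈L)))
      where
      eq : l - l * (1# - y * x) ≈ (l * y) * x
      eq = begin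
        l - l * (1# - y * x)           ≈⟨ +-congˡ (-‿cong (trans (x[y-z]≈xy-xz l 1# (y * x))
                                            (+-congʳ (*-identityʳ l)))) ⟩
        l - (l - l * (y * x))          ≈⟨ +-congˡ (⁻¹-anti-homo-// l _) ⟩
        l + (l * (y * x) - l)          ≈⟨ +-assoc l _ _ ⟨
        (l + l * (y * x)) - l          ≈⟨ xyx⁻¹≈y l _ ⟩
        l * (y * x)                    ≈⟨ *-assoc l y x ⟨
        (l * y) * x                    ∎
    y∉I : y ∉ I
    y∉I y∈I = proj₁ maxL (∈-resp L (x-y+y≈x ring 1# (y * x)) (+-closed L 1-yx∈L (yx∈L y∈I)))
      where
      yx∈L : y ∈ I → y * x ∈ L
      yx∈L = f y
    φ : ∃ (Member (I ⇒ L)) × ∃ (Member (subset I)) → ∃ (Member (L ⇒ I))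
    φ ((x′ , f′) , (i , i∈I)) = (y * x′) * y + i , λ l l∈L → ∈-resp I
      (sym (trans (distribˡ l _ i) (+-congʳ (trans (sym (*-assoc l _ y)) (*-congʳ (sym (*-assoc l y x′)))))))
      (+-closed I
        (y∈L⇒I _ (f′ _ (y∈L⇒I l l∈L)))
        (•-closed I l i∈I))
    δ : ∀ s t → proj₁ (φ s) ≈ proj₁ (φ t) → ∃ (Member (subset L))
    δ ((x₁ , f₁) , (i , i∈I)) ((x₂ , f₂) , (j , j∈I)) eq = x₁ - x₂ , decidable-stable (_ ∈? L) λ ∉L →
      -- Faithfulness cancels the two factors y in turn: y (x₁ - x₂) y ∈ I gives y (x₁ - x₂) ∈ L,
      -- and if x₁ - x₂ were outside L this would put y in I.
      y∉I (⇒-faithful I L maxI (⇒-sub I L f₁ f₂) ∉L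
        (⇒-faithful L I maxL y∈L⇒I y∉I (∈-resp I eq′ (sub-closed I j∈I i∈I))))
      where
      eq′ : j - i ≈ (y * (x₁ - x₂)) * y
      eq′ = begin
        j - i                             ≈⟨ x+y≈z+w⇒x-z≈w-y ring eq ⟨
        (y * x₁) * y - (y * x₂) * y       ≈⟨ [y-z]x≈yx-zx y _ _ ⟨
        (y * x₁ - y * x₂) * y             ≈⟨ *-congʳ (x[y-z]≈xy-xz y x₁ x₂) ⟨
        (y * (x₁ - x₂)) * y               ∎

  module _ (I K L : Ideal) where

    -- R/(K ∩ L) embeds into R/K × R/L, so hom(I, K ∩ L) ≤ hom(I, K) hom(I, L). Adding k and l to
    -- the two copies of x runs through the representatives of each pair of homomorphisms.
    ⇒-∩-bound : ♯ (I ⇒ K ∩ L) ℕ.* (♯ (subset K) ℕ.* ♯ (subset L)) ≤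
                ♯ (subset (K ∩ L)) ℕ.* (♯ (I ⇒ K) ℕ.* ♯ (I ⇒ L))
    ⇒-∩-bound = fibre-bound
      (♯-finite (I ⇒ K ∩ L) ×ᶠ (♯-finite (subset K) ×ᶠ ♯-finite (subset L)))
      (♯-finite (I ⇒ K) ×ᶠ ♯-finite (I ⇒ L)) (♯-finite (subset (K ∩ L)))
      (λ ((x , f) , (k , k∈K) , (l , l∈L)) →
        (x + k , ⇒-+ I K (λ r r∈I → proj₁ (f r r∈I)) (⊆⇒ I K k∈K)) ,
        (x + l , ⇒-+ I L (λ r r∈I → proj₂ (f r r∈I)) (⊆⇒ I L l∈L)))
      (λ ((x , _) , (k , k∈K) , (l , l∈L)) ((y , _) , (k′ , k′∈K) , (l′ , l′∈L)) (p , q) →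
        x - y , ∈-resp K (sym (x+y≈z+w⇒x-z≈w-y ring p)) (sub-closed K k′∈K k∈K)
              , ∈-resp L (sym (x+y≈z+w⇒x-z≈w-y ring q)) (sub-closed L l′∈L l∈L))
      (λ _ _ (p , q) δ≈ → let x≈ = x-z≈y-z⇒x≈y ring δ≈ in
        x≈ , +-cancelˡ _ _ _ (trans p (+-congʳ (sym x≈)))
           , +-cancelˡ _ _ _ (trans q (+-congʳ (sym x≈))))

    -- Since K is not inside the maximal L, K + L = R. Hence R/(K ∩ L) maps onto R/K × R/L, and a
    -- pair of homomorphisms into R/I is recovered from their sum: an x with both K x and L x in I
    -- lies in I, as 1 = (1 - s k) + s k.
    ∩-⇒-bound : IsMaximal L → ∀ {k} → k ∈ K → k ∉ L →
                ♯ (K ⇒ I) ℕ.* ♯ (L ⇒ I) ≤ ♯ (subset I) ℕ.* ♯ (K ∩ L ⇒ I)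
    ∩-⇒-bound (_ , max) {k} k∈K k∉L = fibre-bound
      (♯-finite (K ⇒ I) ×ᶠ ♯-finite (L ⇒ I)) (♯-finite (K ∩ L ⇒ I)) (♯-finite (subset I))
      (λ ((x , f) , (y , g)) → x + y , ⇒-+ (K ∩ L) I
        (λ r r∈ → f r (proj₁ r∈)) (λ r r∈ → g r (proj₂ r∈)))
      (λ ((x , f) , (y , g)) ((x′ , f′) , (y′ , g′)) eq →
        x - x′ , meet (⇒-sub K I f f′)
          (respects (L ⇒ I) (sym (x+y≈z+w⇒x-z≈w-y ring eq)) (⇒-sub L I g′ g)))
      (λ _ _ φ≈ δ≈ → let x≈ = x-z≈y-z⇒x≈y ring δ≈ in
        x≈ , +-cancelˡ _ _ _ (trans φ≈ (+-congʳ (sym x≈))))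
      where
      s = proj₁ (max k k∉L)
      meet : ∀ {x} → Member (K ⇒ I) x → Member (L ⇒ I) x → x ∈ I
      meet {x} f g = ∈-resp I
        (trans (sym (distribʳ x (1# - s * k) (s * k))) (trans (*-congʳ (x-y+y≈x ring 1# (s * k))) (*-identityˡ x)))
        (+-closed I (g _ (proj₂ (max k k∉L))) (f _ (•-closed K s k∈K)))

  module _ (I : Ideal) (maxI : IsMaximal I) where

    -- Rb is a nonzero image of the simple module R/I. Concretely, a nonzero r b has r outside I,
    -- and an inverse s of r modulo I returns b = s (r b).
    principal-minimal : ∀ {b} → Member (annihilator I) b → ¬ b ≈ 0# → Minimal (principal b)
    principal-minimal {b} ann b≉0 =
      (λ isZero → b≉0 (isZero (fromWitness (1# , sym (*-identityˡ b)))))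
      , minimal
      where
      minimal : ∀ J → _
      minimal J J⊆Rb with search
        (λ x≈y (x∈J , x≉0) → ∈-resp J x≈y x∈J , λ y≈0 → x≉0 (trans x≈y y≈0))
        (λ x → (x ∈? J) ×-dec ¬? (x ≟ 0#))
      ... | no ¬∃ = inj₂ (λ {x} x∈J → decidable-stable (x ≟ 0#) (λ x≉0 → ¬∃ (x , x∈J , x≉0)))
      ... | yes (x , x∈J , x≉0) = inj₁ (λ {z} z∈Rb →
        let t , z≈tb = toWitness z∈Rb in ∈-resp J (sym z≈tb) (•-closed J t b∈J))
        where
        r = proj₁ (toWitness (J⊆Rb x∈J))
        x≈rb : x ≈ r * b
        x≈rb = proj₂ (toWitness (J⊆Rb x∈J))
        unit = proj₂ maxI r (λ r∈I → x≉0 (trans x≈rb (ann r r∈I)))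
        s = proj₁ unit
        b∈J : b ∈ J
        b∈J = ∈-resp J (begin
          s * x            ≈⟨ *-congˡ x≈rb ⟩
          s * (r * b)      ≈⟨ *-assoc s r b ⟨
          (s * r) * b      ≈⟨ x∙y⁻¹≈ε⇒x≈y _ _ (trans (sym (1-y*z ring (s * r) b)) (ann _ (proj₂ unit))) ⟨
          b                ∎) (•-closed J s x∈J)

    annihilator⊆Soc : ∀ {b} → Member (annihilator I) b → Left.Soc ring b
    annihilator⊆Soc {b} ann with b ≟ 0#
    ... | yes b≈0 = Left.≈-closed (sym b≈0) Left.0-closed
    ... | no  b≉0 = Left.simple {I = principal b} (principal-minimal ann b≉0) (fromWitness (1# , sym (*-identityˡ b)))

  ♯≤size : ∀ {p} (D : Subset setoid p) → ♯ D ≤ size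
  ♯≤size D = injection⇒≤ (♯-finite D) enumeration proj₁ id

  whole : Ideal
  whole = record
    { subset   = record { Member = λ _ → ⊤ ; respects = λ _ _ → tt ; member? = λ _ → yes tt }
    ; 0-closed = tt
    ; +-closed = λ _ _ → tt
    ; •-closed = λ _ _ → tt
    }

  -- The radical and the size of annihilators

  module _ (frobenius : IsFrobenius ring) where
    open IsFrobenius frobenius
    open LeftModuleMorphisms (leftModuloRad ring) (leftSocle ring)
    open IsLeftModuleIsomorphism (proj₂ left-iso)

    private
      f : Carrier → Carrier
      f x = proj₁ (proj₁ left-iso x)

    x≈y⇒Rad : ∀ {x y} → x ≈ y → Rad ring (x - y)
    x≈y⇒Rad x≈y I _ = ∈-resp I (sym (x≈y⇒x∙y⁻¹≈ε x≈y)) (0-closed I)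

    module _ (I : Ideal) (maxI : IsMaximal I) where

      -- Elements of the annihilator lie in the socle and are lifted along the isomorphism `f` from
      -- R/Rad(R). A lift sends I into Rad(R) because `f` is injective modulo Rad(R), and `f`
      -- recovers b from `g b + k`. The ideal `K` stands for `Rad`, which has no cardinality without
      -- a decision procedure.
      ann×Rad≤⇒ : ∀ K → (∀ {x} → Rad ring x → x ∈ K) → (∀ {x} → x ∈ K → Rad ring x) →
                  ♯ (annihilator I) ℕ.* ♯ (subset K) ≤ ♯ (I ⇒ K)
      ann×Rad≤⇒ K Rad⊆K K⊆Rad = injection⇒≤
        (♯-finite (annihilator I) ×ᶠ ♯-finite (subset K)) (♯-finite (I ⇒ K))
        (λ (b , k , k∈K) → g b + k , ⇒-+ I K (g∈ b) (⊆⇒ I K k∈K))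
        (λ {(b , k , k∈K)} {(b′ , k′ , k′∈K)} eq →
          let b≈b′ = trans (sym (f-gk b k∈K)) (trans (⟦⟧-cong (x≈y⇒Rad eq)) (f-gk b′ k′∈K)) in
          b≈b′ , +-cancelˡ _ _ _ (trans eq (+-congʳ (sym (g-cong b b′ b≈b′)))))
        where
        module ann = Enumeration (♯-finite (annihilator I))
        lift : ∀ b → ∃ λ x → ∀ {z} → Rad ring (z - x) → f z ≈ proj₁ b
        lift (b , ann) = surjective (b , annihilator⊆Soc I maxI ann)
        -- Passing through the enumeration makes the choice of a preimage respect ≈.
        g : ∃ (Member (annihilator I)) → Carrier
        g b = proj₁ (lift (ann.from (ann.to b)))
        g-cong : ∀ b b′ → proj₁ b ≈ proj₁ b′ → g b ≈ g b′
        g-cong b b′ eq = reflexive (≡.cong (λ j → proj₁ (lift (ann.from j))) (ann.to-cong eq))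
        fg : ∀ b → f (g b) ≈ proj₁ b
        fg b = trans (proj₂ (lift (ann.from (ann.to b))) (x≈y⇒Rad refl)) (ann.strictlyInverseʳ b)
        g∈ : ∀ b → Member (I ⇒ K) (g b)
        g∈ b r r∈I = ∈-resp K (trans (+-congˡ -0#≈0#) (+-identityʳ _)) (Rad⊆K (injective (begin
          f (r * g b)   ≈⟨ *ₗ-homo r (g b) ⟩
          r * f (g b)   ≈⟨ *-congˡ (fg b) ⟩
          r * proj₁ b   ≈⟨ proj₂ b r r∈I ⟩
          0#            ≈⟨ 0ᴹ-homo ⟨
          f 0#          ∎)))
        f-gk : ∀ b {k} → k ∈ K → f (g b + k) ≈ proj₁ b
        f-gk b {k} k∈K = begin
          f (g b + k)      ≈⟨ +ᴹ-homo (g b) k ⟩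
          f (g b) + f k    ≈⟨ +-cong (fg b) (trans (⟦⟧-cong k-0∈Rad) 0ᴹ-homo) ⟩
          proj₁ b + 0#     ≈⟨ +-identityʳ _ ⟩
          proj₁ b          ∎
          where
          k-0∈Rad : Rad ring (k - 0#)
          k-0∈Rad L max = ∈-resp L (sym (trans (+-congˡ -0#≈0#) (+-identityʳ _))) (K⊆Rad k∈K L max)

      -- The inequality hom(I, K) ≤ hom(K, I), with both denominators cleared.
      Balanced : Ideal → Set
      Balanced K = ♯ (I ⇒ K) ℕ.* ♯ (subset I) ≤ ♯ (K ⇒ I) ℕ.* ♯ (subset K)

      balanced-∩ : ∀ K L → IsMaximal L → ∀ {k} → k ∈ K → k ∉ L → Balanced K → Balanced (K ∩ L)
      balanced-∩ K L maxL k∈K k∉L bal = balance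
        {x′ = ♯ (I ⇒ K ∩ L)} {x = ♯ (I ⇒ K)} {xl = ♯ (I ⇒ L)} {y = ♯ (K ⇒ I)}
        {{♯-nonZero K}} {{♯-nonZero L}} {{♯-nonZero I}}
        (⇒-∩-bound I K L) (∩-⇒-bound I K L maxL k∈K k∉L) (⇒-symmetric I L maxI maxL) bal

      -- Shrink K inside the family of intersections of maximal ideals; a smallest such K is
      -- the radical.  The goal is decidable, so arguing by contradiction avoids having to
      -- decide whether some maximal ideal fails to contain K.
      annihilator-bound : ♯ (annihilator I) ℕ.* ♯ (subset I) ≤ size
      annihilator-bound = decidable-stable (_ ℕ.≤? _) λ ¬bound →
        descend ¬bound (♯ (subset whole)) whole ℕ.≤-refl (λ _ → tt) balanced-whole
        where
        balanced-whole : Balanced whole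
        balanced-whole = ℕ.≤-trans
          (ℕ.*-mono-≤
            (cardinality-mono enumeration (I ⇒ whole) (subset whole) (λ _ → tt))
            (cardinality-mono enumeration (subset I) (whole ⇒ I) (⊆⇒ whole I)))
          (ℕ.≤-reflexive (ℕ.*-comm (♯ (subset whole)) (♯ (whole ⇒ I))))
        bound : ∀ K → Balanced K → (∀ {x} → Rad ring x → x ∈ K) → (∀ {x} → x ∈ K → Rad ring x) →
                ♯ (annihilator I) ℕ.* ♯ (subset I) ≤ size
        bound K bal Rad⊆K K⊆Rad = cancel-balanced
          {a = ♯ (annihilator I)} {x = ♯ (I ⇒ K)} {y = ♯ (K ⇒ I)} {{♯-nonZero K}}
          (ann×Rad≤⇒ K Rad⊆K K⊆Rad) bal (♯≤size (K ⇒ I))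
        -- The number n bounds `♯ (subset K)`, which is positive because of 0. If some x in K is
        -- missed by a maximal L, then K ∩ L is strictly smaller and still contains Rad(R); so a K
        -- that cannot be shrunk equals Rad(R), where `bound` applies.
        descend : ¬ (♯ (annihilator I) ℕ.* ♯ (subset I) ≤ size) →
                  ∀ n K → ♯ (subset K) ≤ n → (∀ {x} → Rad ring x → x ∈ K) → ¬ Balanced K
        descend ¬bound zero    K ♯K≤n _ _ =
          contradiction (ℕ.>-nonZero⁻¹ (♯ (subset K)) {{♯-nonZero K}}) (ℕ.≤⇒≯ ♯K≤n)
        descend ¬bound (suc n) K ♯K≤n Rad⊆K bal = ¬bound (bound K bal Rad⊆K λ {x} x∈K L maxL →
          decidable-stable (x ∈? L) λ x∉L →
          descend ¬bound n (K ∩ L)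
            (ℕ.s≤s⁻¹ (ℕ.<-≤-trans {♯ (subset (K ∩ L))}
              (cardinality-strict enumeration (subset (K ∩ L)) (subset K) proj₁ x∈K (x∉L ∘ proj₂))
              ♯K≤n))
            (λ rad → Rad⊆K rad , rad L maxL)
            (balanced-∩ K L (maximal⇒isMaximal {L} maxL) x∈K x∉L bal))

-- Submodules of Rᵗ and their orthogonals

funToFin-cong : ∀ {k n} {f g : Fin k → Fin n} → (∀ i → f i ≡ g i) → funToFin f ≡ funToFin g
funToFin-cong {zero}  f≗g = ≡.refl
funToFin-cong {suc k} f≗g = ≡.cong₂ combine (f≗g zero) (funToFin-cong (f≗g ∘ suc))

module Vectors {c ℓ} (R : FiniteRing c ℓ) where
  open FiniteRing R
  open Codes R using (V; word; index; word-index)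
  open Enumeration enumeration using (to; from; strictlyInverseˡ; to-cong; from-cong)
  open VectorEquality setoid using (≋-setoid)
  open SemiringSum semiring using (sum; sum-cong-≋; sum-replicate-zero)

  V-finite : ∀ t → Finite (≋-setoid t) (size ℕ.^ t)
  V-finite t = record
    { to        = index
    ; from      = word
    ; to-cong   = λ u≋v → funToFin-cong (λ i → to-cong (u≋v i))
    ; from-cong = λ { ≡.refl i → refl }
    ; inverse   =
        (λ {k} {v} v≋ → ≡.trans
          (funToFin-cong (λ i → ≡.trans (to-cong (v≋ i)) (strictlyInverseˡ (finToFun k i))))
          (Fin.funToFin-finToFin {t} k))
      , λ { {v} ≡.refl → word-index v }
    }

  size-nonZero : NonZero size
  size-nonZero = Fin.nonZeroIndex (to 0#)

  unit : ∀ {t} → Fin t → V t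
  unit i j = if does (i Fin.≟ j) then 1# else 0#

  sum-unit : ∀ {t} i (f : V t) → sum (λ j → unit i j * f j) ≈ f i
  sum-unit {suc t} zero f = trans
    (+-cong (*-identityˡ _) (trans (sum-cong-≋ (λ j → zeroˡ (f (suc j)))) (sum-replicate-zero t)))
    (+-identityʳ _)
  sum-unit (suc i) f = trans (+-cong (zeroˡ _) (sum-unit i (f ∘ suc))) (+-identityˡ _)

  unit-off : ∀ {t} {i j : Fin t} → ¬ i ≡ j → unit i j ≈ 0#
  unit-off {i = i} {j} i≢j with i Fin.≟ j
  ... | yes i≡j = contradiction i≡j i≢j
  ... | no _    = refl

  infix 4 _VanishesOn_

  _VanishesOn_ : ∀ {t} → V t → (Fin t → Bool) → Set ℓ
  v VanishesOn S = ∀ i → S i ≡ true → v i ≈ 0#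

  vanishesOn? : ∀ {t} (v : V t) S → Dec (v VanishesOn S)
  vanishesOn? v S = Fin.all? (λ i → (S i Bool.≟ true) →-dec (v i ≟ 0#))

  vanishers : ∀ {t} → (Fin t → Bool) → Subset (≋-setoid t) ℓ
  vanishers S = record
    { Member   = _VanishesOn S
    ; respects = λ u≋v z i Si → trans (sym (u≋v i)) (z i Si)
    ; member?  = λ v → vanishesOn? v S
    }

  infixl 7 _∩_

  _∩_ : ∀ {t p q} → Subset (≋-setoid t) p → Subset (≋-setoid t) q → Subset (≋-setoid t) _
  D ∩ E = record
    { Member   = λ v → Member D v × Member E v
    ; respects = λ {u} {v} u≋v (u∈D , u∈E) → respects D {u} {v} u≋v u∈D , respects E {u} {v} u≋v u∈E
    ; member?  = λ v → member? D v ×-dec member? E v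
    }

  -- The power of ∣R∣ with exponent ∣S∣. Subsets of the coordinates are Boolean vectors, so that
  -- this recursion runs parallel to `product` and `∑ₛ`.
  size^ : ∀ {t} → Vec Bool t → ℕ
  size^ []          = 1
  size^ (true ∷ S)  = size ℕ.* size^ S
  size^ (false ∷ S) = size^ S

  -- Coordinates in S are fixed and the others free. Multiplying by `size^ S` avoids the exponent t
  -- - ∣S∣.
  ♯vanishers : ∀ {t} (S : Vec Bool t) →
    size^ S ℕ.* cardinality (V-finite t) (vanishers (lookup S)) ≡ size ℕ.^ t
  ♯vanishers {zero} [] = ≡.cong (1 ℕ.*_) (ℕ.≤-antisym
    (injection⇒≤ (finite-members (V-finite 0) (vanishers (lookup []))) (identity (≡.setoid (Fin 1)))
      (λ _ → zero) (λ _ ()))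
    (injection⇒≤ (identity (≡.setoid (Fin 1))) (finite-members (V-finite 0) (vanishers (lookup [])))
      (λ _ → (λ ()) , λ ()) λ { {zero} {zero} _ → ≡.refl }))
  ♯vanishers {suc t} (true ∷ S) = ≡.trans
    (≡.trans (≡.cong (size^ (true ∷ S) ℕ.*_) step) (ℕ.*-assoc size (size^ S) _))
    (≡.cong (size ℕ.*_) (♯vanishers S))
    where
    step : cardinality (V-finite (suc t)) (vanishers (lookup (true ∷ S))) ≡
           cardinality (V-finite t) (vanishers (lookup S))
    step = ℕ.≤-antisym
      (injection⇒≤ (finite-members (V-finite (suc t)) (vanishers (lookup (true ∷ S))))
        (finite-members (V-finite t) (vanishers (lookup S)))
        (λ (v , z) → v ∘ suc , z ∘ suc)
        (λ { {v , z} {w , z′} eq zero    → trans (z zero ≡.refl) (sym (z′ zero ≡.refl))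
           ; {v , z} {w , z′} eq (suc i) → eq i }))
      (injection⇒≤ (finite-members (V-finite t) (vanishers (lookup S)))
        (finite-members (V-finite (suc t)) (vanishers (lookup (true ∷ S))))
        (λ (v , z) → 0# ∷ᶠ v , λ { zero _ → refl ; (suc i) → z i })
        (λ eq → eq ∘ suc))
  ♯vanishers {suc t} (false ∷ S) = ≡.trans
    (≡.trans (≡.cong (size^ S ℕ.*_) step) (swap (size^ S) size _))
    (≡.cong (size ℕ.*_) (♯vanishers S))
    where
    swap : ∀ a b c → a ℕ.* (b ℕ.* c) ≡ b ℕ.* (a ℕ.* c)
    swap = solve-∀
    step : cardinality (V-finite (suc t)) (vanishers (lookup (false ∷ S))) ≡
           size ℕ.* cardinality (V-finite t) (vanishers (lookup S))
    step = ℕ.≤-antisym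
      (injection⇒≤ (finite-members (V-finite (suc t)) (vanishers (lookup (false ∷ S))))
        (enumeration ×ᶠ finite-members (V-finite t) (vanishers (lookup S)))
        (λ (v , z) → v zero , (v ∘ suc , z ∘ suc))
        (λ { (eq , _) zero → eq ; (_ , eq) (suc i) → eq i }))
      (injection⇒≤ (enumeration ×ᶠ finite-members (V-finite t) (vanishers (lookup S)))
        (finite-members (V-finite (suc t)) (vanishers (lookup (false ∷ S))))
        (λ (r , (v , z)) → r ∷ᶠ v , λ { zero () ; (suc i) → z i })
        (λ eq → eq zero , eq ∘ suc))

-- The form ⟨v , u⟩ = Σ vᵢ mᵢ uᵢ with invertible weights mᵢ.
module Duality {c ℓ} (R : FiniteRing c ℓ) (frobenius : IsFrobenius (FiniteRing.ring R))
  {t : ℕ} (m s : Codes.V R t)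
  (sm≈1 : ∀ i → FiniteRing._≈_ R (FiniteRing._*_ R (s i) (m i)) (FiniteRing.1# R)) where

  open FiniteRing R
  open Codes R using (V)
  open Vectors R
  open LeftIdeals R using (annihilator; annihilator-bound; IsMaximal; ♯-finite) renaming (♯ to ♯ᴿ)
  open VectorEquality setoid using (_≋_; ≋-setoid; ≋-sym; ≋-trans; ≋-refl)
  open RingProperties ring
  open SemiringSum semiring using (sum; sum-cong-≋; ∑-distrib-+; *-distribˡ-sum; sum-replicate-zero)
  open Enumeration (V-finite t) using (search; check)
  open SetoidReasoning setoid

  private
    infixl 6 _⊕_ _⊖_
    infixr 7 _⊙_

    _⊕_ _⊖_ : V t → V t → V t
    (u ⊕ v) i = u i + v i
    (u ⊖ v) i = u i - v i

    _⊙_ : Carrier → V t → V t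
    (r ⊙ v) i = r * v i

    𝟘 : V t
    𝟘 _ = 0#

  record Submodule : Set (Level.suc 0ℓ ⊔ c ⊔ ℓ) where
    field
      subset   : Subset (≋-setoid t) 0ℓ
      0-closed : Member subset 𝟘
      +-closed : ∀ {u v} → Member subset u → Member subset v → Member subset (u ⊕ v)
      *-closed : ∀ r {v} → Member subset v → Member subset (r ⊙ v)

  open Submodule

  infix 4 _∈_ _∉_

  _∈_ _∉_ : V t → Submodule → Set
  v ∈ D = Member (subset D) v
  v ∉ D = ¬ v ∈ D

  _∈?_ : ∀ v D → Dec (v ∈ D)
  v ∈? D = member? (subset D) v

  ∈-resp : ∀ D {u v} → u ≋ v → u ∈ D → v ∈ D
  ∈-resp D {u} {v} = respects (subset D) {u} {v}

  sub-closed : ∀ D {u v} → u ∈ D → v ∈ D → u ⊖ v ∈ D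
  sub-closed D {u} {v} u∈D v∈D = ∈-resp D (λ i → +-congˡ (-1*x≈-x (v i)))
    (+-closed D u∈D (*-closed D (- 1#) v∈D))

  ♯ : ∀ {p} → Subset (≋-setoid t) p → ℕ
  ♯ = cardinality (V-finite t)

  finite : ∀ {p} (D : Subset (≋-setoid t) p) → Finite (members D) (♯ D)
  finite = finite-members (V-finite t)

  ⟪_,_⟫ : V t → V t → Carrier
  ⟪ v , u ⟫ = sum (λ i → v i * (m i * u i))

  ⟪⟫-cong : ∀ {v v′ u u′} → v ≋ v′ → u ≋ u′ → ⟪ v , u ⟫ ≈ ⟪ v′ , u′ ⟫
  ⟪⟫-cong v≋ u≋ = sum-cong-≋ (λ i → *-cong (v≋ i) (*-congˡ (u≋ i)))

  ⟪⟫-+ˡ : ∀ v v′ u → ⟪ v ⊕ v′ , u ⟫ ≈ ⟪ v , u ⟫ + ⟪ v′ , u ⟫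
  ⟪⟫-+ˡ v v′ u = trans (sum-cong-≋ (λ i → distribʳ (m i * u i) (v i) (v′ i)))
    (∑-distrib-+ (λ i → v i * (m i * u i)) (λ i → v′ i * (m i * u i)))

  ⟪⟫-+ʳ : ∀ v u u′ → ⟪ v , u ⊕ u′ ⟫ ≈ ⟪ v , u ⟫ + ⟪ v , u′ ⟫
  ⟪⟫-+ʳ v u u′ = trans
    (sum-cong-≋ (λ i → trans (*-congˡ (distribˡ (m i) (u i) (u′ i))) (distribˡ (v i) _ _)))
    (∑-distrib-+ (λ i → v i * (m i * u i)) (λ i → v i * (m i * u′ i)))

  ⟪⟫-*ˡ : ∀ r v u → ⟪ r ⊙ v , u ⟫ ≈ r * ⟪ v , u ⟫
  ⟪⟫-*ˡ r v u = trans (sum-cong-≋ (λ i → *-assoc r (v i) (m i * u i)))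
    (sym (*-distribˡ-sum r (λ i → v i * (m i * u i))))

  ⟪⟫-0ʳ : ∀ v {u} → (∀ i → v i * (m i * u i) ≈ 0#) → ⟪ v , u ⟫ ≈ 0#
  ⟪⟫-0ʳ v eq = trans (sum-cong-≋ eq) (sum-replicate-zero t)

  ⟪⟫-⊖ʳ : ∀ v {u u′} → ⟪ v , u ⟫ ≈ ⟪ v , u′ ⟫ → ⟪ v , u ⊖ u′ ⟫ ≈ 0#
  ⟪⟫-⊖ʳ v {u} {u′} eq = +-identityˡ-unique _ ⟪ v , u′ ⟫ (begin
    ⟪ v , u ⊖ u′ ⟫ + ⟪ v , u′ ⟫    ≈⟨ ⟪⟫-+ʳ v (u ⊖ u′) u′ ⟨
    ⟪ v , (u ⊖ u′) ⊕ u′ ⟫          ≈⟨ ⟪⟫-cong {v} ≋-refl (λ i → x-y+y≈x ring (u i) (u′ i)) ⟩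
    ⟪ v , u ⟫                      ≈⟨ eq ⟩
    ⟪ v , u′ ⟫                     ∎)

  -- Nondegeneracy of the form; the invertibility of the weights enters here.
  unit-pairing : ∀ i {u} → ⟪ unit i , u ⟫ ≈ 0# → u i ≈ 0#
  unit-pairing i {u} eq = begin
    u i                   ≈⟨ *-identityˡ (u i) ⟨
    1# * u i              ≈⟨ *-congʳ (sm≈1 i) ⟨
    (s i * m i) * u i     ≈⟨ *-assoc (s i) (m i) (u i) ⟩
    s i * (m i * u i)     ≈⟨ *-congˡ (trans (sym (sum-unit i (λ j → m j * u j))) eq) ⟩
    s i * 0#              ≈⟨ zeroʳ (s i) ⟩
    0#                    ∎

  orthogonal : Submodule → Subset (≋-setoid t) (c ⊔ ℓ)
  orthogonal D = record
    { Member   = λ u → ∀ v → v ∈ D → ⟪ v , u ⟫ ≈ 0#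
    ; respects = λ u≋u′ u⊥ v v∈D → trans (⟪⟫-cong {v} ≋-refl (≋-sym u≋u′)) (u⊥ v v∈D)
    ; member?  = λ u → check
        (λ v≋v′ ⊥v v′∈D → trans (⟪⟫-cong {u = u} (≋-sym v≋v′) ≋-refl) (⊥v (∈-resp D (≋-sym v≋v′) v′∈D)))
        (λ v → (v ∈? D) →-dec (⟪ v , u ⟫ ≟ 0#))
    }

  infixl 6 _+R_

  _+R_ : Submodule → V t → Submodule
  D +R d = record
    { subset   = compress S
    ; 0-closed = fromWitness (0# , ∈-resp D
        (λ i → sym (trans (+-congˡ (trans (-‿cong (zeroˡ (d i))) -0#≈0#)) (+-identityʳ 0#))) (0-closed D))
    ; +-closed = λ {u} {v} u∈ v∈ → let r , p = toWitness u∈ ; s , q = toWitness v∈ in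
        fromWitness (r + s , ∈-resp D (λ i → sub-interchange ring (u i) r (v i) s (d i)) (+-closed D p q))
    ; *-closed = λ r {v} v∈ → let s , p = toWitness v∈ in
        fromWitness (r * s , ∈-resp D
          (λ i → trans (x[y-z]≈xy-xz r (v i) (s * d i)) (+-congˡ (-‿cong (sym (*-assoc r s (d i))))))
          (*-closed D r p))
    }
    where
    S : Subset (≋-setoid t) _
    S = record
      { Member   = λ v → ∃ λ r → v ⊖ r ⊙ d ∈ D
      ; respects = λ u≋v (r , p) → r , ∈-resp D (λ i → +-congʳ (u≋v i)) p
      ; member?  = λ v → Enumeration.search enumeration
          (λ r≈s → ∈-resp D (λ i → +-congˡ (-‿cong (*-congʳ r≈s)))) (λ r → (v ⊖ r ⊙ d) ∈? D)
      }

  module _ (D : Submodule) (d : V t) where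

    ⊆+R : ∀ {v} → v ∈ D → v ∈ D +R d
    ⊆+R {v} v∈D = fromWitness (0# , ∈-resp D
      (λ i → sym (trans (+-congˡ (trans (-‿cong (zeroˡ (d i))) -0#≈0#)) (+-identityʳ (v i)))) v∈D)

    multiple∈+R : ∀ r → r ⊙ d ∈ D +R d
    multiple∈+R r = fromWitness (r , ∈-resp D (λ i → sym (-‿inverseʳ (r * d i))) (0-closed D))

    ∈+R : d ∈ D +R d
    ∈+R = ∈-resp (D +R d) (λ i → *-identityˡ (d i)) (multiple∈+R 1#)

    +R-minimal : ∀ E → (∀ {v} → v ∈ D → v ∈ E) → d ∈ E → ∀ {v} → v ∈ D +R d → v ∈ E
    +R-minimal E D⊆E d∈E {v} v∈ = let r , p = toWitness v∈ in
      ∈-resp E (λ i → x-y+y≈x ring (v i) (r * d i)) (+-closed E (D⊆E p) (*-closed E r d∈E))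

    -- The left ideal (D : d), the kernel of r ↦ r d modulo D, so that R/(D : d) ≅ (D + Rd)/D.
    colon : Left.Ideal ring
    colon = record
      { subset   = record
        { Member   = λ r → r ⊙ d ∈ D
        ; respects = λ r≈s → ∈-resp D (λ i → *-congʳ r≈s)
        ; member?  = λ r → (r ⊙ d) ∈? D
        }
      ; 0-closed = ∈-resp D (λ i → sym (zeroˡ (d i))) (0-closed D)
      ; +-closed = λ {r} {s} p q → ∈-resp D (λ i → sym (distribʳ (d i) r s)) (+-closed D p q)
      ; •-closed = λ r {s} p → ∈-resp D (λ i → sym (*-assoc r s (d i))) (*-closed D r p)
      }

    -- Pairing with d maps D⊥ into the right annihilator of `colon`, and its kernel is (D + Rd)⊥.
    orthogonal-+R-bound : ♯ (orthogonal D) ≤ ♯ (orthogonal (D +R d)) ℕ.* ♯ᴿ (annihilator colon)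
    orthogonal-+R-bound = fibre-bound
      (finite (orthogonal D)) (♯-finite (annihilator colon)) (finite (orthogonal (D +R d)))
      (λ (u , u⊥) → ⟪ d , u ⟫ , λ r rd∈D → trans (sym (⟪⟫-*ˡ r d u)) (u⊥ (r ⊙ d) rd∈D))
      (λ (u , u⊥) (w , w⊥) eq → u ⊖ w , λ v v∈ → let r , p = toWitness v∈ in begin
        ⟪ v , u ⊖ w ⟫                                    ≈⟨ ⟪⟫-cong {u = u ⊖ w}
                                                             (λ i → x-y+y≈x ring (v i) (r * d i)) ≋-refl ⟨
        ⟪ (v ⊖ r ⊙ d) ⊕ (r ⊙ d) , u ⊖ w ⟫                ≈⟨ ⟪⟫-+ˡ (v ⊖ r ⊙ d) (r ⊙ d) (u ⊖ w) ⟩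
        ⟪ v ⊖ r ⊙ d , u ⊖ w ⟫ + ⟪ r ⊙ d , u ⊖ w ⟫        ≈⟨ +-cong
                                                             (⟪⟫-⊖ʳ (v ⊖ r ⊙ d) {u} {w} (trans (u⊥ _ p) (sym (w⊥ _ p))))
                                                             (⟪⟫-*ˡ r d (u ⊖ w)) ⟩
        0# + r * ⟪ d , u ⊖ w ⟫                           ≈⟨ +-identityˡ _ ⟩
        r * ⟪ d , u ⊖ w ⟫                                ≈⟨ *-congˡ (⟪⟫-⊖ʳ d {u} {w} eq) ⟩
        r * 0#                                           ≈⟨ zeroʳ r ⟩
        0#                                               ∎)
      (λ _ _ _ δ≈ i → x-z≈y-z⇒x≈y ring (δ≈ i))

    -- The fibres of (v, r) ↦ v + r d on D × R are governed by `colon`: two pairs with the same sum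
    -- have r - s in it.
    +R-bound : ♯ (subset D) ℕ.* size ≤ ♯ᴿ (Left.Ideal.subset colon) ℕ.* ♯ (subset (D +R d))
    +R-bound = fibre-bound
      (finite (subset D) ×ᶠ enumeration) (finite (subset (D +R d)))
      (♯-finite (Left.Ideal.subset colon))
      (λ ((v , v∈D) , r) → v ⊕ r ⊙ d , +-closed (D +R d) (⊆+R v∈D) (multiple∈+R r))
      (λ ((v , v∈D) , r) ((w , w∈D) , s) eq → r - s , ∈-resp D
        (λ i → sym (trans ([y-z]x≈yx-zx (d i) r s)
          (x+y≈z+w⇒x-z≈w-y ring (trans (+-comm _ _) (trans (eq i) (+-comm _ _))))))
        (sub-closed D w∈D v∈D))
      (λ {x} {y} _ _ φ≈ δ≈ → let r≈ = x-z≈y-z⇒x≈y ring δ≈ in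
        (λ i → +-cancelʳ (proj₂ x * d i) _ _ (trans (φ≈ i) (+-congˡ (*-congʳ (sym r≈))))) , r≈)

    simple-step : IsMaximal colon →
      ♯ (orthogonal D) ℕ.* ♯ (subset D) ≤ ♯ (orthogonal (D +R d)) ℕ.* ♯ (subset (D +R d))
    simple-step max = cyclic-bound {o′ = ♯ (orthogonal (D +R d))} {d = ♯ (subset D)} {d′ = ♯ (subset (D +R d))}
      {i = ♯ᴿ (Left.Ideal.subset colon)} {a = ♯ᴿ (annihilator colon)} size {{size-nonZero}}
      orthogonal-+R-bound +R-bound (annihilator-bound frobenius colon max)

  -- Refines D ⊆ E until every step is simple, without constructing a composition series; n bounds
  -- `♯ (subset E)` minus `♯ (subset D)`.
  chain : ∀ n D E → (∀ {v} → v ∈ D → v ∈ E) → ♯ (subset E) ≤ n ℕ.+ ♯ (subset D) →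
          ♯ (orthogonal D) ℕ.* ♯ (subset D) ≤ ♯ (orthogonal E) ℕ.* ♯ (subset E)
  chain n D E D⊆E E≤ with search
    (λ u≋v (u∈E , u∉D) → ∈-resp E u≋v u∈E , u∉D ∘ ∈-resp D (≋-sym u≋v))
    (λ v → (v ∈? E) ×-dec ¬? (v ∈? D))
  ... | no ¬∃ = ℕ.*-mono-≤
    (cardinality-mono (V-finite t) (orthogonal D) (orthogonal E)
      (λ u⊥ v v∈E → u⊥ v (decidable-stable (v ∈? D) (λ v∉D → ¬∃ (v , v∈E , v∉D)))))
    (cardinality-mono (V-finite t) (subset D) (subset E) (λ {v} → D⊆E {v}))
  chain zero D E D⊆E E≤ | yes (d , d∈E , d∉D) =
    contradiction (cardinality-strict (V-finite t) (subset D) (subset E) (λ {v} → D⊆E {v}) {d} d∈E d∉D)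
      (ℕ.≤⇒≯ E≤)
  chain (suc n) D E D⊆E E≤ | yes (d , d∈E , d∉D) = step
    where
    strict : ∀ D E → (∀ {v} → v ∈ D → v ∈ E) → ∀ {v} → v ∈ E → v ∉ D →
             ♯ (subset D) < ♯ (subset E)
    strict D E D⊆E {v} = cardinality-strict (V-finite t) (subset D) (subset E) (λ {v} → D⊆E {v}) {v}
    -- Looks for a submodule D + Re strictly between D and D + Rd. If there is none, then (D + Rd)/D
    -- is simple.
    proper? = search
      {P = λ e → e ∈ D +R d × e ∉ D × d ∉ D +R e}
      (λ {u} {v} u≋v (u∈ , u∉D , d∉) → ∈-resp (D +R d) u≋v u∈ , u∉D ∘ ∈-resp D (≋-sym u≋v) ,
        λ d∈ → let r , p = toWitness d∈ in
          d∉ (fromWitness (r , ∈-resp D (λ i → +-congˡ (-‿cong (*-congˡ (sym (u≋v i))))) p)))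
      (λ e → (e ∈? (D +R d)) ×-dec ¬? (e ∈? D) ×-dec ¬? (d ∈? (D +R e)))
    step : ♯ (orthogonal D) ℕ.* ♯ (subset D) ≤ ♯ (orthogonal E) ℕ.* ♯ (subset E)
    step with proper?
    -- F = D + Re is strictly above D because of e and strictly below E because of d, so both halves
    -- have less fuel to use.
    ... | yes (e , e∈ , e∉D , d∉) = ℕ.≤-trans
      (chain n D F (λ {v} → ⊆+R D e {v}) (fuelˡ {♯ (subset D)} (strict F E (λ {v} → F⊆E {v}) {d} d∈E d∉) E≤))
      (chain n F E (λ {v} → F⊆E {v}) (fuelʳ {♯ (subset D)} (strict D F (λ {v} → ⊆+R D e {v}) {e} (∈+R D e) e∉D) E≤))
      where
      F = D +R e
      F⊆E : ∀ {v} → v ∈ F → v ∈ E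
      F⊆E {v} = +R-minimal D e E D⊆E (+R-minimal D d E D⊆E d∈E e∈) {v}
    ... | no ¬∃ = ℕ.≤-trans (simple-step D d maximal)
      (chain n F E (λ {v} → +R-minimal D d E D⊆E d∈E {v})
        (fuelʳ {♯ (subset D)} (strict D F (λ {v} → ⊆+R D d {v}) {d} (∈+R D d) d∉D) E≤))
      where
      F = D +R d
      -- For r d outside D, the failed search at e = r d places d in D + R(r d); the coefficient
      -- found there inverts r modulo `colon`.
      maximal : IsMaximal (colon D d)
      maximal = (λ 1d∈D → d∉D (∈-resp D (λ i → *-identityˡ (d i)) 1d∈D)) , λ r rd∉D →
        let s , p = toWitness (decidable-stable (d ∈? (D +R r ⊙ d))
              (λ d∉ → ¬∃ (r ⊙ d , multiple∈+R D d r , rd∉D , d∉)))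
        in s , ∈-resp D (λ i → sym (trans ([y-z]x≈yx-zx (d i) 1# (s * r))
                 (+-cong (*-identityˡ (d i)) (-‿cong (*-assoc s r (d i)))))) p

  zeroSubmodule wholeSpace : Submodule
  zeroSubmodule = record
    { subset   = compress S
    ; 0-closed = fromWitness (λ i → refl)
    ; +-closed = λ u∈ v∈ → fromWitness (λ i →
        trans (+-cong (toWitness u∈ i) (toWitness v∈ i)) (+-identityʳ 0#))
    ; *-closed = λ r v∈ → fromWitness (λ i → trans (*-congˡ (toWitness v∈ i)) (zeroʳ r))
    }
    where
    S : Subset (≋-setoid t) _
    S = record
      { Member   = _≋ 𝟘
      ; respects = λ u≋v u≋0 → ≋-trans (≋-sym u≋v) u≋0
      ; member?  = λ u → Fin.all? (λ i → u i ≟ 0#)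
      }
  wholeSpace = record
    { subset   = record { Member = λ _ → ⊤ ; respects = λ _ _ → tt ; member? = λ _ → yes tt }
    ; 0-closed = tt
    ; +-closed = λ _ _ → tt
    ; *-closed = λ _ _ → tt
    }

  ♯≤size^t : ∀ {p} (D : Subset (≋-setoid t) p) → ♯ D ≤ size ℕ.^ t
  ♯≤size^t D = injection⇒≤ (finite D) (V-finite t) proj₁ id

  ♯-nonZero : ∀ D → NonZero (♯ (subset D))
  ♯-nonZero D = cardinality-nonZero (V-finite t) (subset D) (0-closed D)

  duality : ∀ D → ♯ (orthogonal D) ℕ.* ♯ (subset D) ≡ size ℕ.^ t
  duality D = ℕ.≤-antisym upper lower
    where
    ♯whole⊥≤1 : ♯ (orthogonal wholeSpace) ≤ 1
    ♯whole⊥≤1 = injection⇒≤ (finite (orthogonal wholeSpace)) (identity (≡.setoid (Fin 1)))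
      (λ _ → zero)
      (λ {(u , u⊥)} {(v , v⊥)} _ i → trans
        (unit-pairing i {u} (u⊥ (unit i) tt)) (sym (unit-pairing i {v} (v⊥ (unit i) tt))))
    upper : ♯ (orthogonal D) ℕ.* ♯ (subset D) ≤ size ℕ.^ t
    upper = ℕ.≤-trans
      (chain (size ℕ.^ t) D wholeSpace (λ _ → tt)
        (ℕ.≤-trans (♯≤size^t (subset wholeSpace)) (ℕ.m≤m+n _ _)))
      (ℕ.≤-trans (ℕ.*-mono-≤ ♯whole⊥≤1 (♯≤size^t (subset wholeSpace)))
        (ℕ.≤-reflexive (ℕ.*-identityˡ _)))
    size^t≤♯0⊥ : size ℕ.^ t ≤ ♯ (orthogonal zeroSubmodule)
    size^t≤♯0⊥ = injection⇒≤ (V-finite t) (finite (orthogonal zeroSubmodule))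
      (λ u → u , λ v v≋0 → ⟪⟫-0ʳ v (λ i → trans (*-congʳ (toWitness v≋0 i)) (zeroˡ _))) id
    lower : size ℕ.^ t ≤ ♯ (orthogonal D) ℕ.* ♯ (subset D)
    lower = ℕ.≤-trans
      (ℕ.≤-trans (ℕ.≤-reflexive (≡.sym (ℕ.*-identityʳ _)))
        (ℕ.*-mono-≤ size^t≤♯0⊥
          (ℕ.>-nonZero⁻¹ (♯ (subset zeroSubmodule)) {{♯-nonZero zeroSubmodule}})))
      (chain (size ℕ.^ t) zeroSubmodule D
        (λ v≋0 → ∈-resp D (≋-sym (toWitness v≋0)) (0-closed D))
        (ℕ.≤-trans (♯≤size^t (subset D)) (ℕ.m≤m+n _ _)))

  -- Sums with coordinate subspaces

  vanishing : (Fin t → Bool) → Submodule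
  vanishing S = record
    { subset   = compress (vanishers S)
    ; 0-closed = fromWitness (λ i _ → refl)
    ; +-closed = λ u∈ v∈ → fromWitness (λ i Si →
        trans (+-cong (toWitness u∈ i Si) (toWitness v∈ i Si)) (+-identityʳ 0#))
    ; *-closed = λ r v∈ → fromWitness (λ i Si → trans (*-congˡ (toWitness v∈ i Si)) (zeroʳ r))
    }

  infixl 6 _+ˢ_

  _+ˢ_ : Submodule → Submodule → Submodule
  D +ˢ E = record
    { subset   = compress S
    ; 0-closed = fromWitness (𝟘 , 0-closed E , ∈-resp D (λ i → sym (-‿inverseʳ 0#)) (0-closed D))
    ; +-closed = λ {u} {v} u∈ v∈ → let e , e∈E , p = toWitness u∈ ; f , f∈E , q = toWitness v∈ in
        fromWitness (e ⊕ f , +-closed E e∈E f∈E ,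
          ∈-resp D (λ i → x-y+z-w≈x+z-[y+w] ring (u i) (e i) (v i) (f i)) (+-closed D p q))
    ; *-closed = λ r {v} v∈ → let e , e∈E , p = toWitness v∈ in
        fromWitness (r ⊙ e , *-closed E r e∈E ,
          ∈-resp D (λ i → x[y-z]≈xy-xz r (v i) (e i)) (*-closed D r p))
    }
    where
    S : Subset (≋-setoid t) _
    S = record
      { Member   = λ v → ∃ λ e → e ∈ E × v ⊖ e ∈ D
      ; respects = λ u≋v (e , e∈E , p) → e , e∈E , ∈-resp D (λ i → +-congʳ (u≋v i)) p
      ; member?  = λ v → search
          (λ e≋f (e∈E , p) → ∈-resp E e≋f e∈E , ∈-resp D (λ i → +-congˡ (-‿cong (e≋f i))) p)
          (λ e → (e ∈? E) ×-dec ((v ⊖ e) ∈? D))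
      }

  module _ (D E : Submodule) where

    +ˢ-intro : ∀ {d e} → d ∈ D → e ∈ E → d ⊕ e ∈ D +ˢ E
    +ˢ-intro {d} {e} d∈D e∈E = fromWitness (e , e∈E , ∈-resp D (λ i → sym (x+y-y≈x ring (d i) (e i))) d∈D)

    ♯-+ˢ : ♯ (subset D) ℕ.* ♯ (subset E) ≡ ♯ (subset D ∩ subset E) ℕ.* ♯ (subset (D +ˢ E))
    ♯-+ˢ = ℕ.≤-antisym
      (fibre-bound D×E (finite (subset (D +ˢ E))) (finite (subset D ∩ subset E)) add
        (λ ((d , d∈D) , (e , e∈E)) ((d′ , d′∈D) , (e′ , e′∈E)) eq →
          d ⊖ d′ , sub-closed D d∈D d′∈D ,
          ∈-resp E (λ i → sym (x+y≈z+w⇒x-z≈w-y ring (eq i))) (sub-closed E e′∈E e∈E))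
        (λ _ _ φ≈ δ≈ → let d≈ = λ i → x-z≈y-z⇒x≈y ring (δ≈ i) in
          d≈ , λ i → +-cancelˡ _ _ _ (trans (φ≈ i) (+-congʳ (sym (d≈ i))))))
      (fibre-bound-surjective D×E (finite (subset (D +ˢ E))) (finite (subset D ∩ subset E)) add
        (λ (d≈ , e≈) i → +-cong (d≈ i) (e≈ i))
        (λ (v , v∈) → let e , e∈E , p = toWitness v∈ in
          ((v ⊖ e , p) , (e , e∈E)) , λ i → x-y+y≈x ring (v i) (e i))
        (λ (k , k∈D , k∈E) ((d , d∈D) , (e , e∈E)) →
          (k ⊕ d , +-closed D k∈D d∈D) , (e ⊖ k , sub-closed E e∈E k∈E))
        (λ (k , _) ((d , _) , (e , _)) i → begin
          (k i + d i) + (e i - k i)     ≈⟨ +-congʳ (+-comm (k i) (d i)) ⟩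
          (d i + k i) + (e i - k i)     ≈⟨ +-assoc (d i) (k i) _ ⟩
          d i + (k i + (e i - k i))     ≈⟨ +-congˡ (+-assoc (k i) (e i) _) ⟨
          d i + ((k i + e i) - k i)     ≈⟨ +-congˡ (xyx⁻¹≈y (k i) (e i)) ⟩
          d i + e i                     ∎)
        (λ {_} {_} {((d , _) , _)} (k≈ , _) i → +-cancelʳ (d i) _ _ (k≈ i)))
      where
      D×E = finite (subset D) ×ᶠ finite (subset E)
      add : ∃ (_∈ D) × ∃ (_∈ E) → ∃ (_∈ (D +ˢ E))
      add ((d , d∈D) , (e , e∈E)) = d ⊕ e , +ˢ-intro d∈D e∈E

  -- For Z the vectors vanishing on S, (D + Z)⊥ = D⊥ ∩ Z⊥, and Z⊥ consists of the vectors vanishing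
  -- off S: Z contains the unit vectors outside S, and conversely at each coordinate one of the two
  -- factors is zero.
  orthogonal-+-vanishing : ∀ D S →
    ♯ (orthogonal (D +ˢ vanishing S)) ≡ ♯ (orthogonal D ∩ subset (vanishing (not ∘ S)))
  orthogonal-+-vanishing D S = ℕ.≤-antisym
    (cardinality-mono (V-finite t)
      (orthogonal (D +ˢ vanishing S)) (orthogonal D ∩ subset (vanishing (not ∘ S)))
      (λ {u} u⊥ →
        (λ v v∈D → u⊥ v (∈-resp (D +ˢ vanishing S) (λ i → +-identityʳ (v i))
          (+ˢ-intro D (vanishing S) v∈D (0-closed (vanishing S))))) ,
        fromWitness (λ i ¬Si → unit-pairing i {u} (u⊥ (unit i)
          (∈-resp (D +ˢ vanishing S) (λ j → +-identityˡ (unit i j))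
            (+ˢ-intro D (vanishing S) (0-closed D) (fromWitness (λ j Sj → unit-off {i = i} {j}
              (λ { ≡.refl → Bool.not-¬ {S i} ≡.refl (≡.trans Sj (≡.sym ¬Si)) })))))))))
    (cardinality-mono (V-finite t)
      (orthogonal D ∩ subset (vanishing (not ∘ S))) (orthogonal (D +ˢ vanishing S))
      (λ {u} (u⊥ , u∈Z) v v∈ → let e , e∈Z , p = toWitness v∈ in begin
        ⟪ v , u ⟫                    ≈⟨ ⟪⟫-cong {u = u} (λ i → x-y+y≈x ring (v i) (e i)) ≋-refl ⟨
        ⟪ (v ⊖ e) ⊕ e , u ⟫          ≈⟨ ⟪⟫-+ˡ (v ⊖ e) e u ⟩
        ⟪ v ⊖ e , u ⟫ + ⟪ e , u ⟫    ≈⟨ +-cong (u⊥ (v ⊖ e) p)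
                                         (⟪⟫-0ʳ e (λ i → disjoint (S i) ≡.refl (toWitness e∈Z i) (toWitness u∈Z i))) ⟩
        0# + 0#                      ≈⟨ +-identityʳ 0# ⟩
        0#                           ∎))
    where
    disjoint : ∀ b {x y z i} → S i ≡ b → (S i ≡ true → x ≈ 0#) → (not (S i) ≡ true → z ≈ 0#) →
               x * (y * z) ≈ 0#
    disjoint true  Si x≈0 _ = trans (*-congʳ (x≈0 Si)) (zeroˡ _)
    disjoint false Si _ z≈0 = trans (*-congˡ (trans (*-congˡ (z≈0 (≡.cong not Si))) (zeroʳ _))) (zeroʳ _)

  -- For S ⊆ [t] this reads ∣D⊥ ∩ Rˢ∣ ∣D∣ = ∣{v ∈ D : v vanishes on S}∣ ∣R∣ˢ.
  vanishing-duality : ∀ D (S : Vec Bool t) →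
    ♯ (orthogonal D ∩ vanishers (not ∘ lookup S)) ℕ.* ♯ (subset D) ≡
    ♯ (subset D ∩ vanishers (lookup S)) ℕ.* size^ S
  -- Both sides are multiplied by ∣Z∣. Duality for D + Z gives ∣(D + Z)⊥∣ ∣D + Z∣ = `size^ S` ∣Z∣,
  -- and ∣D∣ ∣Z∣ = ∣D ∩ Z∣ ∣D + Z∣ eliminates ∣D + Z∣.
  vanishing-duality D S = ℕ.*-cancelʳ-≡ _ _ (♯ (subset Z)) {{♯-nonZero Z}} (≡.trans
    (transfer-count {w = ♯ (subset (D +ˢ Z))} {d = ♯ (subset D)} {z = ♯ (subset Z)} {k = ♯D∩Z}
      (≡.trans (orthogonal-+-vanishing D (lookup S))
        (decompress (orthogonal D) (not ∘ lookup S)))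
      (≡.trans (duality (D +ˢ Z)) (≡.sym (♯vanishers S)))
      (≡.trans (♯-+ˢ D Z) (≡.cong (ℕ._* ♯ (subset (D +ˢ Z))) (decompress (subset D) (lookup S)))))
    (≡.trans (≡.cong (λ z → ♯D∩Z ℕ.* (size^ S ℕ.* z)) (≡.sym ♯Z))
      (≡.sym (ℕ.*-assoc ♯D∩Z (size^ S) (♯ (subset Z))))))
    where
    Z = vanishing (lookup S)
    ♯D∩Z = ♯ (subset D ∩ vanishers (lookup S))
    ♯Z : ♯ (subset Z) ≡ ♯ (vanishers (lookup S))
    ♯Z = ℕ.≤-antisym
      (cardinality-mono (V-finite t) (subset Z) (vanishers (lookup S)) toWitness)
      (cardinality-mono (V-finite t) (vanishers (lookup S)) (subset Z) fromWitness)
    decompress : ∀ {p} (E : Subset (≋-setoid t) p) T → ♯ (E ∩ subset (vanishing T)) ≡ ♯ (E ∩ vanishers T)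
    decompress E T = ℕ.≤-antisym
      (cardinality-mono (V-finite t) (E ∩ subset (vanishing T)) (E ∩ vanishers T)
        (λ (v∈E , v∈Z) → v∈E , toWitness v∈Z))
      (cardinality-mono (V-finite t) (E ∩ vanishers T) (E ∩ subset (vanishing T))
        (λ (v∈E , v∈Z) → v∈E , fromWitness v∈Z))

-- Polynomial rings

module Polynomials {a ℓ} (A : CommutativeRing a ℓ) where
  open CommutativeRing A hiding (zero; rawRing)
  open RingProperties ring using (-0#≈0#)
  open CommutativeSemigroupProperties +-commutativeSemigroup using (interchange)
  open SetoidReasoning setoid
  open Univariate (CommutativeRing.rawRing A)
  private module P = RawRing rawRing

  -- The product of formal power series. Coefficient lists are equal only up to trailing zeros, so
  -- the multiplicative laws are proved for sequences and pulled back by `coefficient-mul`.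
  convolution : (ℕ → Carrier) → (ℕ → Carrier) → ℕ → Carrier
  convolution f g zero    = f 0 * g 0
  convolution f g (suc k) = f 0 * g (suc k) + convolution (f ∘ suc) g k

  convolution-cong : ∀ {f f′ g g′} → (∀ k → f k ≈ f′ k) → (∀ k → g k ≈ g′ k) →
                     ∀ k → convolution f g k ≈ convolution f′ g′ k
  convolution-cong f≈ g≈ zero    = *-cong (f≈ 0) (g≈ 0)
  convolution-cong f≈ g≈ (suc k) =
    +-cong (*-cong (f≈ 0) (g≈ (suc k))) (convolution-cong (f≈ ∘ suc) g≈ k)

  convolution-0ˡ : ∀ g k → convolution (λ _ → 0#) g k ≈ 0#
  convolution-0ˡ g zero    = zeroˡ _
  convolution-0ˡ g (suc k) = trans (+-cong (zeroˡ _) (convolution-0ˡ g k)) (+-identityʳ 0#)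

  -- The definition splits off the term with `f 0`; commutativity also needs the one with `g 0` at
  -- the opposite end.
  convolution-peelʳ : ∀ f g k → convolution f g (suc k) ≈ convolution f (g ∘ suc) k + f (suc k) * g 0
  convolution-peelʳ f g zero    = refl
  convolution-peelʳ f g (suc k) = trans
    (+-congˡ (convolution-peelʳ (f ∘ suc) g k)) (sym (+-assoc _ _ _))

  convolution-comm : ∀ f g k → convolution f g k ≈ convolution g f k
  convolution-comm f g zero    = *-comm _ _
  convolution-comm f g (suc k) = begin
    f 0 * g (suc k) + convolution (f ∘ suc) g k     ≈⟨ +-comm _ _ ⟩
    convolution (f ∘ suc) g k + f 0 * g (suc k)     ≈⟨ +-cong (convolution-comm (f ∘ suc) g k) (*-comm _ _) ⟩
    convolution g (f ∘ suc) k + g (suc k) * f 0     ≈⟨ convolution-peelʳ g f k ⟨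
    convolution g f (suc k)                         ∎

  convolution-*ˡ : ∀ x f g k → convolution (λ i → x * f i) g k ≈ x * convolution f g k
  convolution-*ˡ x f g zero    = *-assoc _ _ _
  convolution-*ˡ x f g (suc k) = trans
    (+-cong (*-assoc _ _ _) (convolution-*ˡ x (f ∘ suc) g k)) (sym (distribˡ x _ _))

  convolution-+ˡ : ∀ f f′ g k →
                   convolution (λ i → f i + f′ i) g k ≈ convolution f g k + convolution f′ g k
  convolution-+ˡ f f′ g zero    = distribʳ _ _ _
  convolution-+ˡ f f′ g (suc k) = trans
    (+-cong (distribʳ _ _ _) (convolution-+ˡ (f ∘ suc) (f′ ∘ suc) g k)) (interchange _ _ _ _)

  convolution-assoc : ∀ f g h k →
                      convolution (convolution f g) h k ≈ convolution f (convolution g h) k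
  convolution-assoc f g h zero    = *-assoc _ _ _
  convolution-assoc f g h (suc k) = begin
    f 0 * g 0 * h (suc k) + convolution (λ i → f 0 * g (suc i) + convolution (f ∘ suc) g i) h k
      ≈⟨ +-cong (*-assoc _ _ _) (convolution-+ˡ (λ i → f 0 * g (suc i)) (convolution (f ∘ suc) g) h k) ⟩
    f 0 * (g 0 * h (suc k)) + (convolution (λ i → f 0 * g (suc i)) h k + convolution (convolution (f ∘ suc) g) h k)
      ≈⟨ +-congˡ (+-cong (convolution-*ˡ (f 0) (g ∘ suc) h k) (convolution-assoc (f ∘ suc) g h k)) ⟩
    f 0 * (g 0 * h (suc k)) + (f 0 * convolution (g ∘ suc) h k + convolution (f ∘ suc) (convolution g h) k)
      ≈⟨ +-assoc _ _ _ ⟨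
    f 0 * (g 0 * h (suc k)) + f 0 * convolution (g ∘ suc) h k + convolution (f ∘ suc) (convolution g h) k
      ≈⟨ +-congʳ (distribˡ _ _ _) ⟨
    f 0 * convolution g h (suc k) + convolution (f ∘ suc) (convolution g h) k ∎

  coefficient-add : ∀ p q k → coefficient (add p q) k ≈ coefficient p k + coefficient q k
  coefficient-add []      q       k       = sym (+-identityˡ _)
  coefficient-add (a ∷ p) []      k       = sym (+-identityʳ _)
  coefficient-add (a ∷ p) (b ∷ q) zero    = refl
  coefficient-add (a ∷ p) (b ∷ q) (suc k) = coefficient-add p q k

  coefficient-scale : ∀ a p k → coefficient (List.map (a *_) p) k ≈ a * coefficient p k
  coefficient-scale a []      k       = sym (zeroʳ a)
  coefficient-scale a (b ∷ p) zero    = refl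
  coefficient-scale a (b ∷ p) (suc k) = coefficient-scale a p k

  coefficient-neg : ∀ p k → coefficient (List.map -_ p) k ≈ - coefficient p k
  coefficient-neg []      k       = sym -0#≈0#
  coefficient-neg (a ∷ p) zero    = refl
  coefficient-neg (a ∷ p) (suc k) = coefficient-neg p k

  coefficient-mul : ∀ p q k →
                    coefficient (mul p q) k ≈ convolution (coefficient p) (coefficient q) k
  coefficient-mul []      q k       = sym (convolution-0ˡ (coefficient q) k)
  coefficient-mul (a ∷ p) q zero    = trans
    (coefficient-add (List.map (a *_) q) (0# ∷ mul p q) 0)
    (trans (+-identityʳ _) (coefficient-scale a q 0))
  coefficient-mul (a ∷ p) q (suc k) = trans
    (coefficient-add (List.map (a *_) q) (0# ∷ mul p q) (suc k))
    (+-cong (coefficient-scale a q (suc k)) (coefficient-mul p q k))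

  convolution-identityˡ : ∀ p k →
    convolution (coefficient (1# ∷ [])) (coefficient p) k ≈ coefficient p k
  convolution-identityˡ p zero    = *-identityˡ _
  convolution-identityˡ p (suc k) = trans
    (+-cong (*-identityˡ _) (convolution-0ˡ (coefficient p) k)) (+-identityʳ _)

  +-via : ∀ p q r s → (∀ k → coefficient p k + coefficient q k ≈ coefficient r k + coefficient s k) →
          add p q P.≈ add r s
  +-via p q r s eq k = trans (coefficient-add p q k) (trans (eq k) (sym (coefficient-add r s k)))

  *-comm′ : ∀ p q → mul p q P.≈ mul q p
  *-comm′ p q k = trans (coefficient-mul p q k)
    (trans (convolution-comm (coefficient p) (coefficient q) k) (sym (coefficient-mul q p k)))

  *-distribʳ′ : ∀ r p q → mul (add p q) r P.≈ add (mul p r) (mul q r)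
  *-distribʳ′ r p q k = begin
    coefficient (mul (add p q) r) k
      ≈⟨ coefficient-mul (add p q) r k ⟩
    convolution (coefficient (add p q)) (coefficient r) k
      ≈⟨ convolution-cong (coefficient-add p q) (λ _ → refl) k ⟩
    convolution (λ i → coefficient p i + coefficient q i) (coefficient r) k
      ≈⟨ convolution-+ˡ (coefficient p) (coefficient q) (coefficient r) k ⟩
    convolution (coefficient p) (coefficient r) k + convolution (coefficient q) (coefficient r) k
      ≈⟨ +-cong (coefficient-mul p r k) (coefficient-mul q r k) ⟨
    coefficient (mul p r) k + coefficient (mul q r) k
      ≈⟨ coefficient-add (mul p r) (mul q r) k ⟨
    coefficient (add (mul p r) (mul q r)) k ∎

  *-cong′ : ∀ {p p′ q q′} → p P.≈ p′ → q P.≈ q′ → mul p q P.≈ mul p′ q′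
  *-cong′ {p} {p′} {q} {q′} p≈ q≈ k = trans (coefficient-mul p q k)
    (trans (convolution-cong p≈ q≈ k) (sym (coefficient-mul p′ q′ k)))

  *-assoc′ : ∀ p q r → mul (mul p q) r P.≈ mul p (mul q r)
  *-assoc′ p q r k = begin
    coefficient (mul (mul p q) r) k
      ≈⟨ coefficient-mul (mul p q) r k ⟩
    convolution (coefficient (mul p q)) (coefficient r) k
      ≈⟨ convolution-cong (coefficient-mul p q) (λ _ → refl) k ⟩
    convolution (convolution (coefficient p) (coefficient q)) (coefficient r) k
      ≈⟨ convolution-assoc (coefficient p) (coefficient q) (coefficient r) k ⟩
    convolution (coefficient p) (convolution (coefficient q) (coefficient r)) k
      ≈⟨ convolution-cong (λ _ → refl) (coefficient-mul q r) k ⟨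
    convolution (coefficient p) (coefficient (mul q r)) k
      ≈⟨ coefficient-mul p (mul q r) k ⟨
    coefficient (mul p (mul q r)) k ∎

  *-identityˡ′ : ∀ p → mul P.1# p P.≈ p
  *-identityˡ′ p k = trans (coefficient-mul P.1# p k) (convolution-identityˡ p k)

  commutativeRing : CommutativeRing a ℓ
  commutativeRing = record
    { Carrier = P.Carrier
    ; _≈_ = P._≈_
    ; _+_ = P._+_
    ; _*_ = P._*_
    ; -_  = P.-_
    ; 0#  = P.0#
    ; 1#  = P.1#
    ; isCommutativeRing = record
      { isRing = record
        { +-isAbelianGroup = record
          { isGroup = record
            { isMonoid = record
              { isSemigroup = record
                { isMagma = record
                  { isEquivalence = record
                    { refl  = λ _ → refl
                    ; sym   = λ p≈q k → sym (p≈q k)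
                    ; trans = λ p≈q q≈r k → trans (p≈q k) (q≈r k)
                    }
                  ; ∙-cong = λ {p} {p′} {q} {q′} p≈ q≈ → +-via p q p′ q′ (λ k → +-cong (p≈ k) (q≈ k))
                  }
                ; assoc = λ p q r → +-via (add p q) r p (add q r) (λ k → begin
                    coefficient (add p q) k + coefficient r k                 ≈⟨ +-congʳ (coefficient-add p q k) ⟩
                    coefficient p k + coefficient q k + coefficient r k       ≈⟨ +-assoc _ _ _ ⟩
                    coefficient p k + (coefficient q k + coefficient r k)     ≈⟨ +-congˡ (coefficient-add q r k) ⟨
                    coefficient p k + coefficient (add q r) k                 ∎)
                }
              ; identity = (λ p k → refl)
                         , (λ p k → trans (coefficient-add p [] k) (+-identityʳ _))
              }
            ; inverse = (λ p k → trans (coefficient-add (List.map -_ p) p k)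
                          (trans (+-congʳ (coefficient-neg p k)) (-‿inverseˡ _)))
                      , (λ p k → trans (coefficient-add p (List.map -_ p) k)
                          (trans (+-congˡ (coefficient-neg p k)) (-‿inverseʳ _)))
            ; ⁻¹-cong = λ {p} {q} p≈q k → trans (coefficient-neg p k)
                          (trans (-‿cong (p≈q k)) (sym (coefficient-neg q k)))
            }
          ; comm = λ p q → +-via p q q p (λ k → +-comm _ _)
          }
        ; *-cong     = λ {p} {p′} {q} {q′} → *-cong′ {p} {p′} {q} {q′}
        ; *-assoc    = *-assoc′
        ; *-identity = *-identityˡ′
                     , (λ p k → trans (*-comm′ p P.1# k) (*-identityˡ′ p k))
        ; distrib    = (λ r p q k → begin
                           coefficient (mul r (add p q)) k             ≈⟨ *-comm′ r (add p q) k ⟩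
                           coefficient (mul (add p q) r) k             ≈⟨ *-distribʳ′ r p q k ⟩
                           coefficient (add (mul p r) (mul q r)) k     ≈⟨ +-via (mul p r) (mul q r) (mul r p) (mul r q)
                                                                            (λ i → +-cong (*-comm′ p r i) (*-comm′ q r i)) k ⟩
                           coefficient (add (mul r p) (mul r q)) k     ∎)
                     , *-distribʳ′
        }
      ; *-comm = *-comm′
      }
    }

  constant-* : ∀ a b → constant (a * b) P.≈ constant a P.* constant b
  constant-* a b zero          = sym (+-identityʳ _)
  constant-* a b (suc k) = refl

  constant-cong : ∀ {a b} → a ≈ b → constant a P.≈ constant b
  constant-cong a≈b zero    = a≈b
  constant-cong a≈b (suc _) = refl

-- Expanding weight enumerators over sets of coordinates

module Expansion {a ℓ} (Λ : CommutativeRing a ℓ) where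
  open CommutativeRing Λ hiding (zero)
  open RawSemiringDefinitions (Semiring.rawSemiring semiring) using (_^_; product)
  open SemiringSum semiring using (sum; sum-cong-≋; ∑-distrib-+; sum-replicate; sum-permute)
  open SemiringMult semiring using (×1-homo-*; ×-assoc-*; ×-congʳ) renaming (_×_ to _·_)
  open CommutativeSemigroupProperties *-commutativeSemigroup using (interchange; x∙yz≈y∙xz)
  open SetoidReasoning setoid

  sum-transport : ∀ {b ℓb c ℓc m n} {A : Setoid b ℓb} {B : Setoid c ℓc}
    (eA : Finite A m) (eB : Finite B n) (h : Inverse A B) (f : Setoid.Carrier B → Carrier) →
    (∀ {x y} → Setoid._≈_ B x y → f x ≈ f y) →
    sum (f ∘ Inverse.from eB) ≈ sum (f ∘ Inverse.to h ∘ Inverse.from eA)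
  sum-transport {m = m} eA eB h f f-cong = trans
    (sum-permute (f ∘ Inverse.from eB) (Composition.inverse (Symmetry.inverse eA) (Composition.inverse h eB)))
    (sum-cong-≋ {m} (λ i → f-cong (Inverse.strictlyInverseʳ eB (Inverse.to h (Inverse.from eA i)))))

  sum-count : ∀ {n p} {P : Pred (Fin n) p} (P? : Decidable P) x →
              sum (λ i → if does (P? i) then x else 0#) ≈ count P? · x
  sum-count P? x = trans (sum-filter +-commutativeMonoid P? (λ _ → x)) (sum-replicate (count P?))

  product-cong : ∀ {n} {f g : Fin n → Carrier} → (∀ i → f i ≈ g i) → product f ≈ product g
  product-cong {zero}  f≈g = refl
  product-cong {suc n} f≈g = *-cong (f≈g zero) (product-cong (f≈g ∘ suc))

  ∑ₛ : ∀ {t} → (Vec Bool t → Carrier) → Carrier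
  ∑ₛ {zero}  f = f []
  ∑ₛ {suc t} f = ∑ₛ (f ∘ (true ∷_)) + ∑ₛ (f ∘ (false ∷_))

  ∑ₛ-cong : ∀ {t} {f g : Vec Bool t → Carrier} → (∀ S → f S ≈ g S) → ∑ₛ f ≈ ∑ₛ g
  ∑ₛ-cong {zero}  f≈g = f≈g []
  ∑ₛ-cong {suc t} f≈g = +-cong (∑ₛ-cong (f≈g ∘ (true ∷_))) (∑ₛ-cong (f≈g ∘ (false ∷_)))

  *-distribˡ-∑ₛ : ∀ {t} x (f : Vec Bool t → Carrier) → x * ∑ₛ f ≈ ∑ₛ (λ S → x * f S)
  *-distribˡ-∑ₛ {zero}  x f = refl
  *-distribˡ-∑ₛ {suc t} x f = trans (distribˡ x _ _)
    (+-cong (*-distribˡ-∑ₛ x (f ∘ (true ∷_))) (*-distribˡ-∑ₛ x (f ∘ (false ∷_))))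

  sum-∑ₛ-comm : ∀ {n t} (f : Fin n → Vec Bool t → Carrier) →
                sum (λ i → ∑ₛ (f i)) ≈ ∑ₛ (λ S → sum (λ i → f i S))
  sum-∑ₛ-comm {t = zero}  f = refl
  sum-∑ₛ-comm {t = suc t} f = trans
    (∑-distrib-+ (λ i → ∑ₛ (f i ∘ (true ∷_))) (λ i → ∑ₛ (f i ∘ (false ∷_))))
    (+-cong (sum-∑ₛ-comm (λ i → f i ∘ (true ∷_))) (sum-∑ₛ-comm (λ i → f i ∘ (false ∷_))))

  ∑ₛ-if : ∀ {t} b (f : Vec Bool t → Carrier) →
          (if b then ∑ₛ f else 0#) ≈ ∑ₛ (λ S → if b then f S else 0#)
  ∑ₛ-if true  f = refl
  ∑ₛ-if {zero}  false f = refl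
  ∑ₛ-if {suc t} false f = trans (sym (+-identityʳ 0#))
    (+-cong (∑ₛ-if false (f ∘ (true ∷_))) (∑ₛ-if false (f ∘ (false ∷_))))

  product-+ : ∀ {t} (f g : Fin t → Carrier) →
              product (λ i → f i + g i) ≈ ∑ₛ (λ S → product (λ i → if lookup S i then f i else g i))
  product-+ {zero}  f g = refl
  product-+ {suc t} f g = trans (distribʳ _ _ _) (+-cong (half (f zero)) (half (g zero)))
    where
    half : ∀ x → x * product (λ i → f (suc i) + g (suc i)) ≈
           ∑ₛ (λ S → x * product (λ i → if lookup S i then f (suc i) else g (suc i)))
    half x = trans (*-congˡ (product-+ (f ∘ suc) (g ∘ suc))) (*-distribˡ-∑ₛ {t} x _)

  product-0 : ∀ {n} (f : Fin n → Carrier) i → f i ≈ 0# → product f ≈ 0#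
  product-0 f zero    fi≈0 = trans (*-congʳ fi≈0) (zeroˡ _)
  product-0 f (suc i) fi≈0 = trans (*-congˡ (product-0 (f ∘ suc) i fi≈0)) (zeroʳ _)

  -- Makes the monomial of a word a product over coordinates, which can be expanded by
  -- distributivity.
  product-if : ∀ {n p} {P : Pred (Fin n) p} (P? : Decidable P) X Y →
    let w = List.length (List.filter (λ i → ¬? (P? i)) (List.allFin n)) in
    X ^ (n ℕ.∸ w) * Y ^ w ≈ product (λ i → if does (P? i) then X else Y)
  product-if {n} P? X Y = go id
    where
    weight : ∀ {m} → (Fin m → Fin n) → ℕ
    weight g = List.length (List.filter (λ i → ¬? (P? i)) (List.tabulate g))
    weight≤ : ∀ {m} (g : Fin m → Fin n) → weight g ≤ m
    weight≤ g = ℕ.≤-trans (List.length-filter (λ i → ¬? (P? i)) (List.tabulate g))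
      (ℕ.≤-reflexive (List.length-tabulate g))
    go : ∀ {m} (g : Fin m → Fin n) →
         X ^ (m ℕ.∸ weight g) * Y ^ weight g ≈ product (λ i → if does (P? (g i)) then X else Y)
    go {zero}  g = *-identityʳ 1#
    go {suc m} g with P? (g zero)
    ... | yes _ = begin
      X ^ (suc m ℕ.∸ weight (g ∘ suc)) * Y ^ weight (g ∘ suc)
        -- Truncated subtraction commutes with `suc` only because the weight is at most m.
        ≡⟨ ≡.cong (λ k → X ^ k * Y ^ weight (g ∘ suc)) (ℕ.+-∸-assoc 1 (weight≤ (g ∘ suc))) ⟩
      X * X ^ (m ℕ.∸ weight (g ∘ suc)) * Y ^ weight (g ∘ suc)
        ≈⟨ *-assoc X _ _ ⟩
      X * (X ^ (m ℕ.∸ weight (g ∘ suc)) * Y ^ weight (g ∘ suc))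
        ≈⟨ *-congˡ (go (g ∘ suc)) ⟩
      X * product (λ i → if does (P? (g (suc i))) then X else Y) ∎
    ... | no _ = trans (x∙yz≈y∙xz _ Y _) (*-congˡ (go (g ∘ suc)))

  module _ {c ℓ} (R : FiniteRing c ℓ) where
    open FiniteRing R using (_≟_; size) renaming (0# to 0ᴿ)
    open Codes R using (V; word)
    open Vectors R
    open VectorEquality (FiniteRing.setoid R) using (≋-setoid)

    module _ {t} (Z W : Carrier) (T : Fin t → Bool) where

      -- A product of indicators is the indicator of their conjunction: one coordinate of T with a
      -- nonzero entry makes the product zero.
      vanishing-product : ∀ v →
        product (λ i → if T i then (if does (v i ≟ 0ᴿ) then Z else 0#) else W) ≈
        (if does (vanishesOn? v T) then product (λ i → if T i then Z else W) else 0#)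
      vanishing-product v = go (vanishesOn? v T)
        where
        on : ∀ {p} {P : Set p} (d : Dec P) b → (b ≡ true → P) →
             (if b then (if does d then Z else 0#) else W) ≈ (if b then Z else W)
        on (yes _) true  _ = refl
        on (no ¬p) true  p = contradiction (p ≡.refl) ¬p
        on d       false _ = refl
        off : ∀ {p} {P : Set p} (d : Dec P) b → ¬ (b ≡ true → P) →
              (if b then (if does d then Z else 0#) else W) ≈ 0#
        off (yes p) b     ¬imp = contradiction (λ _ → p) ¬imp
        off (no _)  true  ¬imp = refl
        off (no _)  false ¬imp = contradiction (λ ()) ¬imp
        go : (d : Dec (v VanishesOn T)) →
             product (λ i → if T i then (if does (v i ≟ 0ᴿ) then Z else 0#) else W) ≈
             (if does d then product (λ i → if T i then Z else W) else 0#)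
        go (yes vanishes)  = product-cong (λ i → on (v i ≟ 0ᴿ) (T i) (vanishes i))
        go (no ¬vanishes) with Fin.¬∀⟶∃¬ t _ (λ i → (T i Bool.≟ true) →-dec (v i ≟ 0ᴿ)) ¬vanishes
        ... | i , ¬imp = product-0 _ i (off (v i ≟ 0ᴿ) (T i) ¬imp)

    module _ {t p} (D : Subset (≋-setoid t) p) where

      enumerator : Carrier → Carrier → Carrier
      enumerator X Y = sum (λ k → if does (member? D (word {t} k))
        then product {t} (λ i → if does (word {t} k i ≟ 0ᴿ) then X else Y) else 0#)

      private
        -- After the two sums are exchanged, the sum over words for a fixed S only counts the
        -- members of D vanishing on `T S`.
        sum-over-D : ∀ (f : V t → Carrier) (T : Vec Bool t → Fin t → Bool) (m : Vec Bool t → Carrier) →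
          (∀ v → f v ≈ ∑ₛ (λ S → if does (vanishesOn? v (T S)) then m S else 0#)) →
          sum (λ k → if does (member? D (word {t} k)) then f (word k) else 0#) ≈
          ∑ₛ (λ S → cardinality (V-finite t) (D ∩ vanishers (T S)) · m S)
        sum-over-D f T m f≈ = begin
          sum (λ k → if does (member? D (word {t} k)) then f (word k) else 0#)
            ≈⟨ sum-cong-≋ {size ℕ.^ t} (λ k → if-cong (does (member? D (word k))) (f≈ (word k))) ⟩
          sum (λ k → if does (member? D (word k)) then ∑ₛ (g k) else 0#)
            ≈⟨ sum-cong-≋ {size ℕ.^ t} (λ k → ∑ₛ-if (does (member? D (word k))) (g k)) ⟩
          sum (λ k → ∑ₛ (λ S → if does (member? D (word k)) then g k S else 0#))
            ≈⟨ sum-∑ₛ-comm {size ℕ.^ t} {t} (λ k S → if does (member? D (word k)) then g k S else 0#) ⟩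
          ∑ₛ (λ S → sum (λ k → if does (member? D (word k)) then g k S else 0#))
            ≈⟨ ∑ₛ-cong {t} (λ S → sum-cong-≋ {size ℕ.^ t} (λ k →
                 if-∧ (does (member? D (word k))) (does (vanishesOn? (word k) (T S))))) ⟩
          ∑ₛ (λ S → sum (λ k → if does (member? (D ∩ vanishers (T S)) (word k)) then m S else 0#))
            ≈⟨ ∑ₛ-cong {t} (λ S → sum-count (λ k → member? (D ∩ vanishers (T S)) (word k)) (m S)) ⟩
          ∑ₛ (λ S → cardinality (V-finite t) (D ∩ vanishers (T S)) · m S) ∎
          where
          g : Fin (size ℕ.^ t) → Vec Bool t → Carrier
          g k S = if does (vanishesOn? (word k) (T S)) then m S else 0#
          if-cong : ∀ b {x y} → x ≈ y → (if b then x else 0#) ≈ (if b then y else 0#)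
          if-cong true  x≈y = x≈y
          if-cong false _   = refl
          if-∧ : ∀ b b′ {x} → (if b then (if b′ then x else 0#) else 0#) ≈ (if b ∧ b′ then x else 0#)
          if-∧ true  b′ = refl
          if-∧ false b′ = refl

      -- Each factor is W plus Z times the indicator of a zero entry; S collects the coordinates
      -- where the second term is chosen.
      enumerator-vanishing : ∀ Z W → enumerator (Z + W) W ≈
        ∑ₛ (λ S → cardinality (V-finite t) (D ∩ vanishers (lookup S)) ·
                  product (λ i → if lookup S i then Z else W))
      enumerator-vanishing Z W = sum-over-D
        (λ v → product (λ i → if does (v i ≟ 0ᴿ) then Z + W else W)) lookup _ (λ v → begin
        product (λ i → if does (v i ≟ 0ᴿ) then Z + W else W)
          ≈⟨ product-cong {t} (λ i → split (does (v i ≟ 0ᴿ))) ⟩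
        product (λ i → (if does (v i ≟ 0ᴿ) then Z else 0#) + W)
          ≈⟨ product-+ {t} (λ i → if does (v i ≟ 0ᴿ) then Z else 0#) (λ _ → W) ⟩
        ∑ₛ (λ S → product (λ i → if lookup S i then (if does (v i ≟ 0ᴿ) then Z else 0#) else W))
          ≈⟨ ∑ₛ-cong {t} (λ S → vanishing-product Z W (lookup S) v) ⟩
        ∑ₛ (λ S → if does (vanishesOn? v (lookup S)) then product (λ i → if lookup S i then Z else W) else 0#) ∎)
        where
        split : ∀ b → (if b then Z + W else W) ≈ (if b then Z else 0#) + W
        split true  = refl
        split false = sym (+-identityˡ W)

      -- Each factor is Y plus X - Y times the indicator of a zero entry. Now S collects the
      -- coordinates where Y is chosen, so the word must vanish off S, as `vanishing-duality`
      -- requires of the dual.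
      enumerator-covanishing : ∀ X Y → enumerator X Y ≈
        ∑ₛ (λ S → cardinality (V-finite t) (D ∩ vanishers (not ∘ lookup S)) ·
                  product (λ i → if lookup S i then Y else X - Y))
      enumerator-covanishing X Y = trans
        (sum-over-D (λ v → product (λ i → if does (v i ≟ 0ᴿ) then X else Y)) (λ S → not ∘ lookup S)
          (λ S → product (λ i → if not (lookup S i) then X - Y else Y)) (λ v → begin
          product (λ i → if does (v i ≟ 0ᴿ) then X else Y)
            ≈⟨ product-cong {t} (λ i → split (does (v i ≟ 0ᴿ))) ⟩
          product (λ i → Y + (if does (v i ≟ 0ᴿ) then X - Y else 0#))
            ≈⟨ product-+ {t} (λ _ → Y) (λ i → if does (v i ≟ 0ᴿ) then X - Y else 0#) ⟩
          ∑ₛ (λ S → product (λ i → if lookup S i then Y else (if does (v i ≟ 0ᴿ) then X - Y else 0#)))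
            ≈⟨ ∑ₛ-cong {t} (λ S → product-cong {t} (λ i → if-not′ (lookup S i))) ⟩
          ∑ₛ (λ S → product (λ i → if not (lookup S i) then (if does (v i ≟ 0ᴿ) then X - Y else 0#) else Y))
            ≈⟨ ∑ₛ-cong {t} (λ S → vanishing-product (X - Y) Y (not ∘ lookup S) v) ⟩
          ∑ₛ (λ S → if does (vanishesOn? v (not ∘ lookup S))
                    then product (λ i → if not (lookup S i) then X - Y else Y) else 0#) ∎))
        (∑ₛ-cong {t} (λ S → ×-congʳ (cardinality (V-finite t) (D ∩ vanishers (not ∘ lookup S)))
          (product-cong {t} (λ i → sym (if-not′ (lookup S i))))))
        where
        split : ∀ b → (if b then X else Y) ≈ Y + (if b then X - Y else 0#)
        split true  = sym (trans (+-comm Y (X - Y)) (x-y+y≈x ring X Y))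
        split false = sym (+-identityʳ Y)
        if-not′ : ∀ b {x y} → (if b then x else y) ≈ (if not b then y else x)
        if-not′ true  = refl
        if-not′ false = refl

    product-size^ : ∀ {t} (S : Vec Bool t) Q Y W → Q ≈ size · 1# →
      product (λ i → if lookup S i then Q * Y else W) ≈
      (size^ S · 1#) * product (λ i → if lookup S i then Y else W)
    product-size^ [] Q Y W Q≈ = sym (trans (*-identityʳ _) (+-identityʳ 1#))
    product-size^ (true ∷ S) Q Y W Q≈ = begin
      Q * Y * product (λ i → if lookup S i then Q * Y else W)
        ≈⟨ *-cong (*-congʳ Q≈) (product-size^ S Q Y W Q≈) ⟩
      (size · 1#) * Y * ((size^ S · 1#) * product (λ i → if lookup S i then Y else W))
        ≈⟨ interchange _ _ _ _ ⟩
      (size · 1#) * (size^ S · 1#) * (Y * product (λ i → if lookup S i then Y else W))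
        ≈⟨ *-congʳ (×1-homo-* size (size^ S)) ⟨
      (size^ (true ∷ S) · 1#) * (Y * product (λ i → if lookup S i then Y else W)) ∎
    product-size^ (false ∷ S) Q Y W Q≈ = trans (*-congˡ (product-size^ S Q Y W Q≈)) (x∙yz≈y∙xz _ _ _)

    module MacWilliams (frobenius : IsFrobenius (FiniteRing.ring R)) {t : ℕ} (m s : V t)
      (sm≈1 : ∀ i → FiniteRing._≈_ R (FiniteRing._*_ R (s i) (m i)) (FiniteRing.1# R)) where
      open Duality R frobenius m s sm≈1

      -- With Z = Q Y and W = X - Y the expansions of both sides agree term by term: for each S both
      -- carry the product of Y over S and X - Y off S, and `vanishing-duality` compares the
      -- coefficients.
      macwilliams : ∀ (D : Submodule) κ Q X Y →
        κ * (♯ (Submodule.subset D) · 1#) ≈ 1# → Q ≈ size · 1# →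
        enumerator (orthogonal D) X Y ≈
        κ * enumerator (Submodule.subset D) (Q * Y + (X - Y)) (X - Y)
      macwilliams D κ Q X Y κ≈ Q≈ = begin
        enumerator (orthogonal D) X Y
          ≈⟨ enumerator-covanishing (orthogonal D) X Y ⟩
        ∑ₛ (λ S → ♯D⊥∩ S · M S)
          ≈⟨ ∑ₛ-cong term ⟩
        ∑ₛ (λ S → κ * (♯D∩ S · product (λ i → if lookup S i then Q * Y else X - Y)))
          ≈⟨ *-distribˡ-∑ₛ {t} κ (λ S → ♯D∩ S · product (λ i → if lookup S i then Q * Y else X - Y)) ⟨
        κ * ∑ₛ (λ S → ♯D∩ S · product (λ i → if lookup S i then Q * Y else X - Y))
          ≈⟨ *-congˡ (enumerator-vanishing (Submodule.subset D) (Q * Y) (X - Y)) ⟨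
        κ * enumerator (Submodule.subset D) (Q * Y + (X - Y)) (X - Y) ∎
        where
        M : Vec Bool t → Carrier
        M S = product (λ i → if lookup S i then Y else X - Y)
        ♯D⊥∩ ♯D∩ : Vec Bool t → ℕ
        ♯D⊥∩ S = ♯ (orthogonal D ∩ vanishers (not ∘ lookup S))
        ♯D∩ S = ♯ (Submodule.subset D ∩ vanishers (lookup S))
        ∣D∣ = ♯ (Submodule.subset D)
        scalar-multiple : ∀ n x → n · x ≈ (n · 1#) * x
        scalar-multiple n x = sym (trans (×-assoc-* n 1# x) (×-congʳ n (*-identityˡ x)))
        term : ∀ S → ♯D⊥∩ S · M S ≈ κ * (♯D∩ S · product (λ i → if lookup S i then Q * Y else X - Y))
        term S = begin
          ♯D⊥∩ S · M S                                    ≈⟨ scalar-multiple (♯D⊥∩ S) (M S) ⟩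
          (♯D⊥∩ S · 1#) * M S                             ≈⟨ *-congʳ (trans (*-congˡ κ≈) (*-identityʳ _)) ⟨
          (♯D⊥∩ S · 1#) * (κ * (∣D∣ · 1#)) * M S          ≈⟨ *-congʳ (x∙yz≈y∙xz _ κ _) ⟩
          κ * ((♯D⊥∩ S · 1#) * (∣D∣ · 1#)) * M S          ≈⟨ *-congʳ (*-congˡ (×1-homo-* (♯D⊥∩ S) ∣D∣)) ⟨
          κ * ((♯D⊥∩ S ℕ.* ∣D∣) · 1#) * M S               ≡⟨ ≡.cong (λ n → κ * (n · 1#) * M S) (vanishing-duality D S) ⟩
          κ * ((♯D∩ S ℕ.* size^ S) · 1#) * M S            ≈⟨ *-congʳ (*-congˡ (×1-homo-* (♯D∩ S) (size^ S))) ⟩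
          κ * ((♯D∩ S · 1#) * (size^ S · 1#)) * M S       ≈⟨ trans (*-assoc κ _ _) (*-congˡ (*-assoc _ _ _)) ⟩
          κ * ((♯D∩ S · 1#) * ((size^ S · 1#) * M S))     ≈⟨ *-congˡ (*-congˡ (product-size^ S Q Y (X - Y) Q≈)) ⟨
          κ * ((♯D∩ S · 1#) * product (λ i → if lookup S i then Q * Y else X - Y))
                                                          ≈⟨ *-congˡ (scalar-multiple (♯D∩ S) _) ⟨
          κ * (♯D∩ S · product (λ i → if lookup S i then Q * Y else X - Y)) ∎

-- Orbit coordinates

module Folding {c ℓ} (R : FiniteRing c ℓ) (frobenius : IsFrobenius (FiniteRing.ring R))
  {n} (H : PermutationGroup n) (1/∣H∣ : Codes.InvertibleOrder R H)
  {t} (orbits : OrbitRepresentatives H t) where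

  open FiniteRing R
  open Codes R
  open Averaging H 1/∣H∣
  open Vectors R using (unit; sum-unit)
  open PermutationGroup H
  open OrbitRepresentatives orbits
  open VectorEquality setoid using (_≋_; ≋-setoid; ≋-sym; ≋-trans)
  open RingProperties ring
  open SemiringSum semiring
    using (sum; sum-cong-≋; ∑-distrib-+; ∑-comm; *-distribˡ-sum; *-distribʳ-sum;
           sum-permute; sum-replicate; sum-replicate-zero)
  open SemiringMult semiring using (×-assoc-*; ×-comm-*; ×-congʳ) renaming (_×_ to _×#_)
  open SetoidReasoning setoid

  private
    ρ ∣H∣ : Carrier
    ρ = proj₁ 1/∣H∣
    ∣H∣ = order ×# 1#

  ∣H∣-multiple : ∀ x → order ×# x ≈ ∣H∣ * x
  ∣H∣-multiple x = sym (trans (×-assoc-* order 1# x) (×-congʳ order (*-identityˡ x)))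

  ρ∣H∣ : ∀ x → ρ * (order ×# x) ≈ x
  ρ∣H∣ x = begin
    ρ * (order ×# x)    ≈⟨ *-congˡ (∣H∣-multiple x) ⟩
    ρ * (∣H∣ * x)       ≈⟨ *-assoc ρ ∣H∣ x ⟨
    ρ * ∣H∣ * x         ≈⟨ *-congʳ (proj₁ (proj₂ 1/∣H∣)) ⟩
    1# * x              ≈⟨ *-identityˡ x ⟩
    x                   ∎

  -- The inverse of the central element ∣H∣ · 1 is central. Over a noncommutative R this is what
  -- makes θ left linear and lets the factor ρ leave the second argument of the form.
  ρ-central : ∀ x → ρ * x ≈ x * ρ
  ρ-central x = begin
    ρ * x                     ≈⟨ *-congˡ (trans (sym (*-identityʳ x)) (*-congˡ (sym (proj₂ (proj₂ 1/∣H∣))))) ⟩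
    ρ * (x * (∣H∣ * ρ))       ≈⟨ *-congˡ (*-assoc x ∣H∣ ρ) ⟨
    ρ * (x * ∣H∣ * ρ)         ≈⟨ *-congˡ (*-congʳ x∣H∣) ⟩
    ρ * (order ×# x * ρ)      ≈⟨ *-assoc ρ _ ρ ⟨
    ρ * (order ×# x) * ρ      ≈⟨ *-congʳ (ρ∣H∣ x) ⟩
    x * ρ                     ∎
    where
    x∣H∣ : x * ∣H∣ ≈ order ×# x
    x∣H∣ = trans (×-comm-* order x 1#) (×-congʳ order (*-identityʳ x))

  x*ρy≈ρ*xy : ∀ x y → x * (ρ * y) ≈ ρ * (x * y)
  x*ρy≈ρ*xy x y = trans (sym (*-assoc x ρ y)) (trans (*-congʳ (sym (ρ-central x))) (*-assoc ρ x y))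

  ⟨⟩-permute : ∀ (v u : V n) k → ⟨ v , u · element k ⟩ ≈ ⟨ v · Perm.flip (element k) , u ⟩
  ⟨⟩-permute v u k = trans
    (sum-permute (λ i → v i * u (element k ⟨$⟩ˡ i)) (element k))
    (sum-cong-≋ {n} (λ i → *-congˡ (reflexive (≡.cong u (Perm.inverseˡ (element k))))))

  ⟨⟩-θʳ : ∀ v u → ⟨ v , u θ ⟩ ≈ ρ * sum (λ k → ⟨ v · Perm.flip (element k) , u ⟩)
  ⟨⟩-θʳ v u = begin
    sum (λ i → v i * (ρ * sum (λ k → (u · element k) i)))
      ≈⟨ sum-cong-≋ {n} (λ i → trans (x*ρy≈ρ*xy (v i) _) (*-congˡ (*-distribˡ-sum (v i) (λ k → (u · element k) i)))) ⟩
    sum (λ i → ρ * sum (λ k → v i * (u · element k) i))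
      ≈⟨ *-distribˡ-sum ρ (λ i → sum (λ k → v i * (u · element k) i)) ⟨
    ρ * sum (λ i → sum (λ k → v i * (u · element k) i))
      ≈⟨ *-congˡ (∑-comm (λ i k → v i * (u · element k) i)) ⟩
    ρ * sum (λ k → ⟨ v , u · element k ⟩)
      ≈⟨ *-congˡ (sum-cong-≋ {order} (⟨⟩-permute v u)) ⟩
    ρ * sum (λ k → ⟨ v · Perm.flip (element k) , u ⟩) ∎

  Invariant : V n → Set ℓ
  Invariant u = ∀ k i → u (element k ⟨$⟩ʳ i) ≈ u i

  invariant-θ : ∀ {u} → Invariant u → u ≋ (u θ)
  invariant-θ {u} inv i = sym (trans (*-congˡ (trans
    (sum-cong-≋ {order} (λ k → trans (sym (inv k _)) (reflexive (≡.cong u (Perm.inverseʳ (element k))))))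
    (sum-replicate order))) (ρ∣H∣ (u i)))

  -- Every translate of v by H pairs with an invariant u as v does, so averaging changes nothing.
  ⟨⟩-θˡ : ∀ v {u} → Invariant u → ⟨ v θ , u ⟩ ≈ ⟨ v , u ⟩
  ⟨⟩-θˡ v {u} inv = begin
    sum (λ i → ρ * sum (λ k → (v · element k) i) * u i)
      ≈⟨ sum-cong-≋ {n} (λ i → trans (*-assoc ρ _ (u i)) (*-congˡ (*-distribʳ-sum (u i) (λ k → (v · element k) i)))) ⟩
    sum (λ i → ρ * sum (λ k → (v · element k) i * u i))
      ≈⟨ *-distribˡ-sum ρ (λ i → sum (λ k → (v · element k) i * u i)) ⟨
    ρ * sum (λ i → sum (λ k → (v · element k) i * u i))
      ≈⟨ *-congˡ (∑-comm (λ i k → (v · element k) i * u i)) ⟩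
    ρ * sum (λ k → ⟨ v · element k , u ⟩)
      ≈⟨ *-congˡ (sum-cong-≋ {order} shift) ⟩
    ρ * sum {order} (λ k → ⟨ v , u ⟩)
      ≈⟨ *-congˡ (sum-replicate order) ⟩
    ρ * (order ×# ⟨ v , u ⟩)
      ≈⟨ ρ∣H∣ _ ⟩
    ⟨ v , u ⟩ ∎
    where
    shift : ∀ k → ⟨ v · element k , u ⟩ ≈ ⟨ v , u ⟩
    shift k = trans
      (sum-permute (λ i → (v · element k) i * u i) (element k))
      (sum-cong-≋ {n} (λ i → *-cong (reflexive (≡.cong v (Perm.inverseˡ (element k)))) (inv k i)))

  θ-+ : ∀ u v i → (u θ) i + (v θ) i ≈ ((λ j → u j + v j) θ) i
  θ-+ u v i = trans (sym (distribˡ ρ _ _))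
    (*-congˡ (sym (∑-distrib-+ (λ k → (u · element k) i) (λ k → (v · element k) i))))

  θ-* : ∀ r v i → r * (v θ) i ≈ ((λ j → r * v j) θ) i
  θ-* r v i = trans (x*ρy≈ρ*xy r _) (*-congˡ (*-distribˡ-sum r (λ k → (v · element k) i)))

  private
    χ : Fin t → V n
    χ = orbitVector orbits

    comb : V t → V n
    comb = combination orbits

    coords : V n → V t
    coords = coordinates orbits

  indicator-central : ∀ b x → (if b then 1# else 0#) * x ≈ x * (if b then 1# else 0#)
  indicator-central true  x = trans (*-identityˡ x) (sym (*-identityʳ x))
  indicator-central false x = trans (zeroˡ x) (sym (zeroʳ x))

  χ-restrict : ∀ i {x : Carrier} (f : V n) →
    (∀ j → InOrbit H (α i) j → f j ≈ x) → ∀ j → χ i j * f j ≈ χ i j * x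
  χ-restrict i f f≈ j = restrict (inOrbit? H (α i) j)
    where
    restrict : (d : Dec (InOrbit H (α i) j)) →
               (if does d then 1# else 0#) * f j ≈ (if does d then 1# else 0#) * _
    restrict (yes i∼j) = *-congˡ (f≈ j i∼j)
    restrict (no _)    = trans (zeroˡ _) (sym (zeroˡ _))

  comb-cong : ∀ {a b} → a ≋ b → comb a ≋ comb b
  comb-cong a≋b j = sum-cong-≋ {t} (λ i → *-congʳ (a≋b i))

  comb-+ : ∀ a b j → comb a j + comb b j ≈ comb (λ i → a i + b i) j
  comb-+ a b j = sym (trans (sum-cong-≋ {t} (λ i → distribʳ (χ i j) (a i) (b i)))
    (∑-distrib-+ (λ i → a i * χ i j) (λ i → b i * χ i j)))

  comb-* : ∀ r a j → r * comb a j ≈ comb (λ i → r * a i) j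
  comb-* r a j = trans (*-distribˡ-sum r (λ i → a i * χ i j))
    (sum-cong-≋ {t} (λ i → sym (*-assoc r (a i) (χ i j))))

  comb-0 : ∀ j → comb (λ _ → 0#) j ≈ 0#
  comb-0 j = trans (sum-cong-≋ {t} (λ i → zeroˡ (χ i j))) (sum-replicate-zero t)

  comb-invariant : ∀ a → Invariant (comb a)
  comb-invariant a k j with partition j
  ... | i , (l , αi·l≡j) , _ = trans
    (combination-at orbits a i _ (proj₁ lk , ≡.trans (≡.sym (proj₂ lk (α i))) (≡.cong (element k ⟨$⟩ʳ_) αi·l≡j)))
    (sym (combination-at orbits a i j (l , αi·l≡j)))
    where lk = ∘-closed (element l) (element k) (l , λ _ → ≡.refl) (k , λ _ → ≡.refl)

  coords-comb : ∀ a → coords (comb a) ≋ a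
  coords-comb a = coordinates-unique orbits {comb a} {a} (λ _ → refl)

  orbitSize : V t
  orbitSize i = sum (χ i)

  -- `comb a` takes the constant value `a i` on the orbit of `α i`, so the positions of that orbit
  -- together contribute its length.
  ⟨⟩-comb : ∀ b a → ⟨ comb b , comb a ⟩ ≈ sum (λ i → b i * (orbitSize i * a i))
  ⟨⟩-comb b a = begin
    sum (λ j → comb b j * comb a j)
      ≈⟨ sum-cong-≋ {n} (λ j → *-distribʳ-sum (comb a j) (λ i → b i * χ i j)) ⟩
    sum (λ j → sum (λ i → b i * χ i j * comb a j))
      ≈⟨ ∑-comm (λ j i → b i * χ i j * comb a j) ⟩
    sum (λ i → sum (λ j → b i * χ i j * comb a j))
      ≈⟨ sum-cong-≋ {t} (λ i → sum-cong-≋ {n} (λ j → trans (*-assoc (b i) (χ i j) (comb a j))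
           (*-congˡ (χ-restrict i (comb a) (combination-at orbits a i) j)))) ⟩
    sum (λ i → sum (λ j → b i * (χ i j * a i)))
      ≈⟨ sum-cong-≋ {t} (λ i → sym (*-distribˡ-sum (b i) (λ j → χ i j * a i))) ⟩
    sum (λ i → b i * sum (λ j → χ i j * a i))
      ≈⟨ sum-cong-≋ {t} (λ i → *-congˡ (sym (*-distribʳ-sum (a i) (χ i)))) ⟩
    sum (λ i → b i * (orbitSize i * a i)) ∎

  -- ∣Stab(αᵢ)∣ / ∣H∣, obtained by averaging the unit vector at αᵢ.
  1/orbitSize : V t
  1/orbitSize i = (unit (α i) θ) (α i)

  -- The pairing of χ i with the averaged unit vector, computed twice. That average is constant on
  -- the orbit, which gives the product on the left. Moving θ to the other argument gives the
  -- average over H of the entries of χ i at images of `α i`, all equal to 1.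
  1/orbitSize-inverse : ∀ i → 1/orbitSize i * orbitSize i ≈ 1#
  1/orbitSize-inverse i = begin
    e θ[α] * sum (χ i)                                  ≈⟨ *-distribˡ-sum (e θ[α]) (χ i) ⟩
    sum (λ j → e θ[α] * χ i j)                          ≈⟨ sum-cong-≋ {n} (λ j → sym (indicator-central
                                                             (does (inOrbit? H (α i) j)) _)) ⟩
    sum (λ j → χ i j * e θ[α])                          ≈⟨ sum-cong-≋ {n} (λ j → sym (χ-restrict i (e θ) θ-const j)) ⟩
    ⟨ χ i , e θ ⟩                                       ≈⟨ ⟨⟩-θʳ (χ i) e ⟩
    ρ * sum (λ k → ⟨ χ i · Perm.flip (element k) , e ⟩) ≈⟨ *-congˡ (sum-cong-≋ {order} at-α) ⟩
    ρ * sum {order} (λ _ → 1#)                          ≈⟨ *-congˡ (sum-replicate order) ⟩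
    ρ * (order ×# 1#)                                   ≈⟨ ρ∣H∣ 1# ⟩
    1#                                                  ∎
    where
    e : V n
    e = unit (α i)
    _θ[α] : V n → Carrier
    v θ[α] = (v θ) (α i)
    θ-const : ∀ j → InOrbit H (α i) j → (e θ) j ≈ e θ[α]
    θ-const j (k , ≡.refl) = θ-invariant e k (α i)
    at-α : ∀ k → ⟨ χ i · Perm.flip (element k) , e ⟩ ≈ 1#
    at-α k = begin
      sum (λ j → χ i (element k ⟨$⟩ʳ j) * e j)     ≈⟨ sum-cong-≋ {n} (λ j → sym (indicator-central _ _)) ⟩
      sum (λ j → e j * χ i (element k ⟨$⟩ʳ j))     ≈⟨ sum-unit (α i) (λ j → χ i (element k ⟨$⟩ʳ j)) ⟩
      χ i (element k ⟨$⟩ʳ α i)                     ≡⟨ ≡.cong (if_then 1# else 0#)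
                                                        (dec-true (inOrbit? H (α i) _) (k , ≡.refl)) ⟩
      1#                                           ∎

  open Duality R frobenius orbitSize 1/orbitSize 1/orbitSize-inverse public
    using (Submodule; orthogonal)

  θ-expand : ∀ {p} {X : VSubset n p} {u} → Member (X [θ]) u → comb (coords u) ≋ u
  θ-expand {u = u} (v , v∈X , u≋vθ) = ≋-trans (comb-cong (λ i → u≋vθ (α i)))
    (≋-trans (≋-sym (coordinates-expand orbits 1/∣H∣ v)) (≋-sym u≋vθ))

  coordinate-inverse : ∀ {p q} (X : VSubset n p) (D : Subset (≋-setoid t) q) →
    (∀ {a} → Member D a → Member (X [θ]) (comb a)) → (∀ {a} → Member (X [θ]) (comb a) → Member D a) →
    Inverse (members D) (members (X [θ]))
  coordinate-inverse X D ⇒ ⇐ = record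
    { to        = λ (a , a∈D) → comb a , ⇒ a∈D
    ; from      = λ (u , u∈) → coords u , ⇐ (respects (X [θ]) (≋-sym (θ-expand {X = X} u∈)) u∈)
    ; to-cong   = comb-cong
    ; from-cong = λ u≋v i → u≋v (α i)
    ; inverse   =
        (λ {(u , u∈)} a≋ → ≋-trans (comb-cong a≋) (θ-expand {X = X} u∈))
      , (λ {(a , _)} u≋ → ≋-trans (λ i → u≋ (α i)) (coords-comb a))
    }

  module _ {p} {G : PermutationGroup n} (H≤G : H ≤ₚ G) (C : LeftGCode G p) where
    open LeftGCode C renaming (codewords to cw)

    sum-closed : ∀ {m} (f : Fin m → V n) → (∀ k → Member cw (f k)) →
                 Member cw (λ i → sum (λ k → f k i))
    sum-closed {zero}  f f∈ = 0-closed
    sum-closed {suc m} f f∈ = +-closed (f∈ zero) (sum-closed (f ∘ suc) (f∈ ∘ suc))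

    element∈G : ∀ k → PermutationGroup.Elem G (element k)
    element∈G k = H≤G {element k} (k , λ _ → ≡.refl)

    θ-closed : ∀ {v} → Member cw v → Member cw (v θ)
    θ-closed {v} v∈C = *-closed ρ (sum-closed (λ k → v · element k)
      (λ k → ·-closed (element k) (element∈G k) v∈C))

    -- Moving the outer θ across the form leaves an average of pairings of u with translates of v θ,
    -- and these translates all lie in C.
    θ⊥θ : ∀ {v u} → Member cw v → Member (cw ⊥) u → ⟨ v θ , u θ ⟩ ≈ 0#
    θ⊥θ {v} {u} v∈C u∈C⊥ = trans (⟨⟩-θʳ (v θ) u) (trans
      (*-congˡ (trans (sum-cong-≋ {order} (λ k → u∈C⊥ _ (·-closed (Perm.flip (element k))
        (PermutationGroup.flip-closed G (element k) (element∈G k)) (θ-closed v∈C))))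
        (sum-replicate-zero order)))
      (zeroʳ ρ))

    folded : Submodule
    folded = record
      { subset   = compress S
      ; 0-closed = fromWitness ((λ _ → 0#) , 0-closed , λ j → trans (comb-0 j) (sym (0θ≋0 j)))
      ; +-closed = λ {a} {b} a∈ b∈ → let v , v∈C , a≋ = toWitness a∈ ; w , w∈C , b≋ = toWitness b∈ in
          fromWitness ((λ j → v j + w j) , +-closed v∈C w∈C , λ j →
            trans (sym (comb-+ a b j)) (trans (+-cong (a≋ j) (b≋ j)) (θ-+ v w j)))
      ; *-closed = λ r {a} a∈ → let v , v∈C , a≋ = toWitness a∈ in
          fromWitness ((λ j → r * v j) , *-closed r v∈C , λ j →
            trans (sym (comb-* r a j)) (trans (*-congˡ (a≋ j)) (θ-* r v j)))
      }
      where
      S : Subset (≋-setoid t) _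
      S = record
        { Member   = λ a → Member (cw [θ]) (comb a)
        ; respects = λ {a} {b} a≋b → respects (cw [θ]) {comb a} {comb b} (comb-cong a≋b)
        ; member?  = λ a → member? (cw [θ]) (comb a)
        }

    folded-inverse : Inverse (members (Submodule.subset folded)) (members (cw [θ]))
    folded-inverse = coordinate-inverse cw (Submodule.subset folded) toWitness fromWitness

    -- If a is orthogonal to the folded code, `comb a` lies in C⊥ itself, since pairing with an
    -- invariant vector does not distinguish v from v θ; being invariant, it is its own average. The
    -- converse is `θ⊥θ`.
    orthogonal-inverse : Inverse (members (orthogonal folded)) (members ((cw ⊥) [θ]))
    orthogonal-inverse = coordinate-inverse (cw ⊥) (orthogonal folded) ⇒ ⇐
      where
      ⇒ : ∀ {a} → Member (orthogonal folded) a → Member ((cw ⊥) [θ]) (comb a)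
      ⇒ {a} a⊥ = comb a , comb∈C⊥ , invariant-θ (comb-invariant a)
        where
        comb∈C⊥ : Member (cw ⊥) (comb a)
        comb∈C⊥ v v∈C = begin
          ⟨ v , comb a ⟩                       ≈⟨ ⟨⟩-θˡ v (comb-invariant a) ⟨
          ⟨ v θ , comb a ⟩                     ≈⟨ ⟨⟩-congˡ (comb a) (coordinates-expand orbits 1/∣H∣ v) ⟩
          ⟨ comb (coords (v θ)) , comb a ⟩     ≈⟨ ⟨⟩-comb (coords (v θ)) a ⟩
          sum (λ i → coords (v θ) i * (orbitSize i * a i))
                                               ≈⟨ a⊥ (coords (v θ)) (fromWitness
                                                    (v , v∈C , ≋-sym (coordinates-expand orbits 1/∣H∣ v))) ⟩
          0#                                   ∎
      ⇐ : ∀ {a} → Member ((cw ⊥) [θ]) (comb a) → Member (orthogonal folded) a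
      ⇐ {a} (u , u∈C⊥ , a≋uθ) b b∈ = let v , v∈C , b≋vθ = toWitness b∈ in begin
        sum (λ i → b i * (orbitSize i * a i))  ≈⟨ ⟨⟩-comb b a ⟨
        ⟨ comb b , comb a ⟩                    ≈⟨ trans (⟨⟩-congˡ (comb a) b≋vθ) (⟨⟩-congʳ (v θ) a≋uθ) ⟩
        ⟨ v θ , u θ ⟩                          ≈⟨ θ⊥θ v∈C u∈C⊥ ⟩
        0#                                     ∎

-- Natural numbers and their inverses as scalars of the polynomial ring

[1+n]/1 : ∀ n → + suc n / 1 ≡ 1ℚ ℚ.+ + n / 1
[1+n]/1 n = ℚ.toℚᵘ-injective (begin
  ℚ.toℚᵘ (+ suc n / 1)                ≈⟨ ℚ.toℚᵘ-fromℚᵘ (mkℚᵘ (+ suc n) 0) ⟩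
  mkℚᵘ (+ suc n) 0                    ≈⟨ *≡* (≡.cong (ℤ._* + 1) (≡.cong (ℤ._+_ (+ 1)) (≡.sym (ℤ.*-identityʳ (+ n))))) ⟩
  mkℚᵘ (+ 1) 0 ℚᵘ.+ mkℚᵘ (+ n) 0      ≈⟨ ℚᵘ.+-congʳ (mkℚᵘ (+ 1) 0) (ℚ.toℚᵘ-fromℚᵘ (mkℚᵘ (+ n) 0)) ⟨
  ℚ.toℚᵘ 1ℚ ℚᵘ.+ ℚ.toℚᵘ (+ n / 1)     ≈⟨ ℚ.toℚᵘ-homo-+ 1ℚ (+ n / 1) ⟨
  ℚ.toℚᵘ (1ℚ ℚ.+ + n / 1)             ∎)
  where open SetoidReasoning ℚᵘ.≃-setoid

-- Checked on unnormalised fractions, because `_/_` divides by a gcd that does not reduce for a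
-- variable n.
1/n*n≡1 : ∀ n .{{_ : NonZero n}} → (+ 1 / n) ℚ.* (+ n / 1) ≡ 1ℚ
1/n*n≡1 (suc n) = ℚ.toℚᵘ-injective (begin
  ℚ.toℚᵘ ((+ 1 / suc n) ℚ.* (+ suc n / 1))            ≈⟨ ℚ.toℚᵘ-homo-* (+ 1 / suc n) (+ suc n / 1) ⟩
  ℚ.toℚᵘ (+ 1 / suc n) ℚᵘ.* ℚ.toℚᵘ (+ suc n / 1)      ≈⟨ ℚᵘ.*-cong (ℚ.toℚᵘ-fromℚᵘ (mkℚᵘ (+ 1) n))
                                                                      (ℚ.toℚᵘ-fromℚᵘ (mkℚᵘ (+ suc n) 0)) ⟩
  mkℚᵘ (+ 1) n ℚᵘ.* mkℚᵘ (+ suc n) 0                  ≈⟨ ℚᵘ.*-inverseˡ (mkℚᵘ (+ suc n) 0) ⟩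
  ℚᵘ.1ℚᵘ                                              ∎)
  where open SetoidReasoning ℚᵘ.≃-setoid

module ℚX = Polynomials ℚ.+-*-commutativeRing
module ℚXY = Polynomials ℚX.commutativeRing

Λ : CommutativeRing _ _
Λ = ℚXY.commutativeRing

module _ where
  open CommutativeRing Λ
  open SemiringMult semiring using () renaming (_×_ to _·_)
  open ℚ[x,y] using (scalar)
  open SetoidReasoning setoid

  scalar-* : ∀ p q → scalar p * scalar q ≈ scalar (p ℚ.* q)
  scalar-* p q = sym {scalar (p ℚ.* q)} {scalar p * scalar q}
    (trans {scalar (p ℚ.* q)} {ℚ[x][y].constant (ℚ[x].mul cp cq)} {scalar p * scalar q}
      (ℚXY.constant-cong {ℚ[x].constant (p ℚ.* q)} {ℚ[x].mul cp cq} (ℚX.constant-* p q))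
      (ℚXY.constant-* cp cq))
    where
    cp = ℚ[x].constant p
    cq = ℚ[x].constant q

  scalar-ℕ : ∀ n → scalar (+ n / 1) ≈ n · 1#
  -- `scalar` of 0 is the nested list with the single entry 0, which equals the empty list only
  -- coefficient by coefficient.
  scalar-ℕ zero    = λ { zero → λ { zero → ≡.refl ; (suc _) → ≡.refl } ; (suc _) _ → ≡.refl }
  scalar-ℕ (suc n) = begin
    scalar (+ suc n / 1)            ≡⟨ ≡.cong scalar ([1+n]/1 n) ⟩
    scalar 1ℚ + scalar (+ n / 1)    ≈⟨ +-congˡ {1#} {scalar (+ n / 1)} {n · 1#} (scalar-ℕ n) ⟩
    1# + n · 1#                     ∎

  scalar-inverse : ∀ n .{{_ : NonZero n}} → scalar (+ 1 / n) * (n · 1#) ≈ 1#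
  scalar-inverse n = begin
    scalar (+ 1 / n) * (n · 1#)               ≈⟨ *-congˡ {scalar (+ 1 / n)} {n · 1#} {scalar (+ n / 1)}
                                                   (sym {scalar (+ n / 1)} {n · 1#} (scalar-ℕ n)) ⟩
    scalar (+ 1 / n) * scalar (+ n / 1)       ≈⟨ scalar-* (+ 1 / n) (+ n / 1) ⟩
    scalar ((+ 1 / n) ℚ.* (+ n / 1))          ≡⟨ ≡.cong scalar (1/n*n≡1 n) ⟩
    scalar 1ℚ                                 ∎

  scalar-pred : ∀ n → scalar (+ n / 1 -ℚ 1ℚ) + 1# ≈ n · 1#
  scalar-pred n = begin
    scalar (+ n / 1 -ℚ 1ℚ) + 1#       ≡⟨⟩
    scalar ((+ n / 1 -ℚ 1ℚ) ℚ.+ 1ℚ)   ≡⟨ ≡.cong scalar (x-y+y≈x ℚ.+-*-ring (+ n / 1) 1ℚ) ⟩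
    scalar (+ n / 1)                  ≈⟨ scalar-ℕ n ⟩
    n · 1#                            ∎

module _ {c ℓ} (A : CommutativeRing c ℓ) where
  open CommutativeRing A
  open SetoidReasoning setoid

  [a+1]y+[x-y]≈x+ay : ∀ a x y → (a + 1#) * y + (x - y) ≈ x + a * y
  [a+1]y+[x-y]≈x+ay a x y = begin
    (a + 1#) * y + (x - y)    ≈⟨ +-congʳ (trans (distribʳ y a 1#) (+-congˡ (*-identityˡ y))) ⟩
    (a * y + y) + (x - y)     ≈⟨ +-assoc _ _ _ ⟩
    a * y + (y + (x - y))     ≈⟨ +-congˡ (trans (+-comm y (x - y)) (x-y+y≈x ring x y)) ⟩
    a * y + x                 ≈⟨ +-comm _ _ ⟩
    x + a * y                 ∎

-- Weight enumerators in orbit coordinates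

module _ {c ℓ} (R : FiniteRing c ℓ) where
  open FiniteRing R using (_≟_; size)
    renaming (0# to 0ᴿ; setoid to setoidᴿ; trans to transᴿ; sym to symᴿ)
  open Codes R
  open Vectors R
  open VectorEquality setoidᴿ using (_≋_; ≋-setoid)
  open CommutativeRing Λ using (_≈_; 0#; +-commutativeMonoid; setoid; semiring)
  open ℚ[x,y] using (_^_; _*_; sum)
  open RawSemiringDefinitions (Semiring.rawSemiring semiring) using (product)
  open Expansion Λ
  open SetoidReasoning setoid

  module _ {n t} {H : PermutationGroup n} (orbits : OrbitRepresentatives H t)
    {p q} (X : VSubset n p) (D : Subset (≋-setoid t) q) (h : Inverse (members D) (members X))
    (h-coordinates : ∀ a → coordinates orbits (proj₁ (Inverse.to h a)) ≋ proj₁ a) where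

    -- The H-weight depends on orbit coordinates only, so the sum over words of length n can be
    -- carried along `h` to one over words of length t, where it is an ordinary weight enumerator.
    weightEnumerator-coordinates : ∀ A B → weightEnumerator orbits X A B ≈ enumerator R D A B
    weightEnumerator-coordinates A B = begin
      weightEnumerator orbits X A B
        ≈⟨ sum-filter +-commutativeMonoid (λ k → member? X (word k)) (λ k → monomial (word k)) ⟩
      sum (λ j → monomial (proj₁ (eX.from j)))
        ≈⟨ SΛ.sum-cong-≋ {cardinality (V-finite n) X} (λ j →
             product-if (λ i → coordinates orbits (proj₁ (eX.from j)) i ≟ 0ᴿ) A B) ⟩
      sum (λ j → factors (coordinates orbits (proj₁ (eX.from j))))
        ≈⟨ sum-transport eD.finite eX.finite h (λ u → factors (coordinates orbits (proj₁ u)))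
             (λ u≋v → factors-cong (λ i → u≋v (α i))) ⟩
      sum (λ j → factors (coordinates orbits (proj₁ (Inverse.to h (eD.from j)))))
        ≈⟨ SΛ.sum-cong-≋ {cardinality (V-finite t) D} (λ j → factors-cong (h-coordinates (eD.from j))) ⟩
      sum (λ j → factors (proj₁ (eD.from j)))
        ≈⟨ sum-filter +-commutativeMonoid (λ k → member? D (word k)) (λ k → factors (word k)) ⟨
      enumerator R D A B ∎
      where
      open OrbitRepresentatives orbits using (α)
      module SΛ = SemiringSum semiring
      module eX where
        finite = finite-members (V-finite n) X
        open Inverse finite public
      module eD where
        finite = finite-members (V-finite t) D
        open Inverse finite public
      monomial : V n → ℚ[x,y].Carrier
      monomial u = A ^ (t ℕ.∸ H-weight orbits u) * B ^ H-weight orbits u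
      factors : V t → ℚ[x,y].Carrier
      factors a = product (λ i → if does (a i ≟ 0ᴿ) then A else B)
      factors-cong : ∀ {a b} → a ≋ b → factors a ≈ factors b
      factors-cong {a} {b} a≋b = product-cong (λ i →
        CommutativeRing.reflexive Λ (≡.cong (if_then A else B)
          (does-⇔ (mk⇔ (transᴿ (symᴿ (a≋b i))) (transᴿ (a≋b i))) (a i ≟ 0ᴿ) (b i ≟ 0ᴿ))))

  enumerator-congˡ : ∀ {t q} (D : Subset (≋-setoid t) q) {A A′} B → A ≈ A′ →
                     enumerator R D A B ≈ enumerator R D A′ B
  enumerator-congˡ {t} D {A} {A′} B A≈A′ = SemiringSum.sum-cong-≋ semiring {size ℕ.^ t} (λ k →
    if-cong (does (member? D (word k))) (product-cong {t} (λ i → choose (does (word k i ≟ 0ᴿ)))))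
    where
    if-cong : ∀ b {x y} → x ≈ y → (if b then x else 0#) ≈ (if b then y else 0#)
    if-cong true  x≈y = x≈y
    if-cong false _   = CommutativeRing.refl Λ {0#}
    choose : ∀ b → (if b then A else B) ≈ (if b then A′ else B)
    choose true  = A≈A′
    choose false = CommutativeRing.refl Λ {B}

theorem3p2 : ∀ {c ℓ p : Level} (R : FiniteRing c ℓ) →
    IsFrobenius (FiniteRing.ring R) →
    let open Codes R in
    (n : ℕ) (G H : PermutationGroup n) → H ≤ₚ G →
    (1/∣H∣ : InvertibleOrder H) →
    (t : ℕ) (orbits : OrbitRepresentatives H t) →
    (C : LeftGCode G p) →
    let open Averaging H 1/∣H∣ in
    let open ℚ[x,y] in
    let Cθ = codewords C [θ] in
    let C⊥θ = (codewords C ⊥) [θ] in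
    let instance ∣Cθ∣≢0 = ∣ Cθ ∣-nonZero (0∈[θ] (codewords C) (LeftGCode.0-closed C)) in
    weightEnumerator orbits C⊥θ x y
    ≈ scalar (+ 1 / ∣ Cθ ∣)
    * weightEnumerator orbits Cθ (x + scalar (+ FiniteRing.size R / 1 -ℚ 1ℚ) * y) (x - y)
theorem3p2 R frobenius n G H H≤G 1/∣H∣ t orbits C = begin
  weightEnumerator orbits C⊥θ x y
    ≈⟨ weightEnumerator-coordinates R orbits C⊥θ (orthogonal D) (orthogonal-inverse (λ {g} → H≤G {g}) C)
         (λ (a , _) → coords-comb a) x y ⟩
  enumerator R (orthogonal D) x y
    -- Q is taken as σ + 1, which is ∣R∣ as a scalar; then Q y + (x - y) is the required x + (∣R∣ -
    -- 1) y.
    ≈⟨ MacWilliams.macwilliams R frobenius orbitSize 1/orbitSize 1/orbitSize-inverse D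
         κ (σ + 1#) x y κ-inverse (scalar-pred (FiniteRing.size R)) ⟩
  κ * enumerator R (Submodule.subset D) ((σ + 1#) * y + (x - y)) (x - y)
    ≈⟨ *-congˡ′ {enumerator R (Submodule.subset D) ((σ + 1#) * y + (x - y)) (x - y)}
         {enumerator R (Submodule.subset D) (x + σ * y) (x - y)}
         (enumerator-congˡ R (Submodule.subset D) {(σ + 1#) * y + (x - y)} {x + σ * y} (x - y)
           ([a+1]y+[x-y]≈x+ay Λ σ x y)) ⟩
  κ * enumerator R (Submodule.subset D) (x + σ * y) (x - y)
    ≈⟨ *-congˡ′ {weightEnumerator orbits Cθ (x + σ * y) (x - y)}
         {enumerator R (Submodule.subset D) (x + σ * y) (x - y)}
         (weightEnumerator-coordinates R orbits Cθ (Submodule.subset D) (folded-inverse (λ {g} → H≤G {g}) C)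
         (λ (a , _) → coords-comb a) (x + σ * y) (x - y)) ⟨
  κ * weightEnumerator orbits Cθ (x + σ * y) (x - y) ∎
  where
  open Codes R
  open Averaging H 1/∣H∣
  open ℚ[x,y]
  open Folding R frobenius H 1/∣H∣ orbits
  open Vectors R using (V-finite)
  open Expansion Λ
  open SemiringMult (CommutativeRing.semiring Λ) using () renaming (_×_ to _·Λ_)
  open SetoidReasoning (CommutativeRing.setoid Λ)
  Cθ = codewords C [θ]
  C⊥θ = (codewords C ⊥) [θ]
  D = folded (λ {g} → H≤G {g}) C
  instance
    ∣Cθ∣≢0 : NonZero ∣ Cθ ∣
    ∣Cθ∣≢0 = ∣ Cθ ∣-nonZero (0∈[θ] (codewords C) (LeftGCode.0-closed C))
  κ = scalar (+ 1 / ∣ Cθ ∣)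
  σ = scalar (+ FiniteRing.size R / 1 -ℚ 1ℚ)
  *-congˡ′ : ∀ {p q} → p ≈ q → κ * p ≈ κ * q
  *-congˡ′ {p} {q} = CommutativeRing.*-congˡ Λ {κ} {p} {q}
  -- The factor κ refers to Cθ among words of length n, while `macwilliams` counts its image among
  -- words of length t.
  ♯D : cardinality (V-finite t) (Submodule.subset D) ≡ ∣ Cθ ∣
  ♯D = finite-unique (finite-members (V-finite t) (Submodule.subset D))
    (Composition.inverse (folded-inverse (λ {g} → H≤G {g}) C) (finite-members (V-finite n) Cθ))
  κ-inverse : κ * (cardinality (V-finite t) (Submodule.subset D) ·Λ 1#) ≈ 1#
  κ-inverse = ≡.subst (λ k → κ * (k ·Λ 1#) ≈ 1#) (≡.sym ♯D) (scalar-inverse ∣ Cθ ∣)
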